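{- Let $S=\langle\mathbf{a}_1,\dots,\mathbf{a}_k\rangle$ be the affine monoid generated by $\mathbf{a}_1,\dots,\mathbf{a}_k\in\mathbb{Z}_{\ge 0}^d\setminus\{0\}$, and let $\Lambda=\{\mathbf{a}_{k-n+1},\dots,\mathbf{a}_k\}$, $n\le k$, be such that $pos(S)=pos(\Lambda)$. Let $\prec_\Lambda$ be a block ordering on $\mathbb{Q}[x_1,\dots,x_d,y_1,\dots,y_k]$ of the type described in the context. Then $$\mathcal{Q}_{\prec_\Lambda}(S)=Ap(S,\Lambda).$$
   Context: $S=\langle\mathbf{a}_1,\dots,\mathbf{a}_k\rangle$ is the set of all $\mathbb{Z}_{\ge 0}$-linear combinations of $\mathbf{a}_1,\dots,\mathbf{a}_k$. Write $\mathbf{a}_j=(a_{1j},\dots,a_{dj})$. For a finite set of vectors $\{\mathbf{b}_1,\dots,\mathbf{b}_m\}$, $pos(\{\mathbf{b}_1,\dots,\mathbf{b}_m\})$ is the rational cone $\{\lambda_1\mathbf{b}_1+\dots+\lambda_m\mathbf{b}_m\mid\lambda_i\in\mathbb{Q}_{\ge0}\}$, and $pos(S)=pos(\{\mathbf{a}_1,\dots,\mathbf{a}_k\})$. Apéry set of $S$ with respect to $\Lambda$: $Ap(S,\Lambda)=\{\mathbf{a}\in S\mid \mathbf{a}-\mathbf{b}\notin S\ \text{for all}\ \mathbf{b}\in\Lambda\}$. Ordering: $\prec_\Lambda$ is a block (elimination) ordering which first compares the $x$-parts of two monomials by an arbitrary monomial ordering $\prec_x$ on $x_1,\dots,x_d$,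 and, if these coincide, compares the $y$-parts by an $S$-graded reverse lexicographical ordering $\prec_y$ on $y_1,\dots,y_k$ for which every variable $y_i$ with $i\in\{k-n+1,\dots,k\}$ is smaller than every variable $y_j$ with $j\in\{1,\dots,k-n\}$. Here "$S$-graded reverse lexicographical" means: first the $S$-degrees $\sum_i u_i\mathbf{a}_i\in\mathbb{Z}_{\ge0}^d$ of the monomials $\mathbf{y}^{\mathbf{u}}$ are compared (by a fixed monomial ordering on $\mathbb{Z}_{\ge 0}^d$, e.g. the lexicographic one); ties are broken reverse lexicographically, i.e. for distinct monomials of the same $S$-degree, look at the smallest variable in which the exponents differ, and the monomial with the larger exponent there is the smaller monomial. For example, for $y_k\prec_y\dots\prec_y y_1$, ties are broken by declaring smaller the monomial with larger exponent of $y_k$, then of $y_{k-1}$, and so on. Ideal: $I_S$ is the kernel of the ring homomorphism $\mathbb{Q}[x_1,\dots,x_d,y_1,\dots,y_k]\to\mathbb{Q}[x_1,\dots,x_d]$ with $y_j\mapsto\mathbf{x}^{\mathbf{a}_j}:=x_1^{a_{1j}}\cdots x_d^{a_{dj}}$ and $x_i\mapsto x_i$. Let $\mathcal{B}_\Lambda$ be the reduced Groebner basis of $I_S$ with respect to $\prec_\Lambda$ and $N_\Lambda$ the normal form operator with respect to $\mathcal{B}_\Lambda$ (the normal form of a monomial is a monomial). For a nonzero polynomial $g$, $\exp(g)\in\mathbb{Z}_{\ge0}^{d+k}$ is the exponent of its leading monomial with respect to $\prec_\Lambda$. Let $E(I_S)=\bigcup_{g\in\mathcal{B}_\Lambda}\left(\exp(g)+\mathbb{Z}_{\ge0}^{d+k}\right)$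 and $\overline{E(I_S)}=\mathbb{Z}_{\ge0}^{d+k}\setminus E(I_S)$. Write $z_1,\dots,z_n$ for $y_{k-n+1},\dots,y_k$; coordinates of $\mathbb{Z}_{\ge0}^{d+k}$ are named after the variables. Define $$\mathcal{Q}_{\prec_\Lambda}(S)=\left\{\mathbf{a}\in\mathbb{Z}_{\ge0}^d\mid\exp\left(N_\Lambda(\mathbf{x}^{\mathbf{a}})\right)\in\{x_1=\dots=x_d=z_1=\dots=z_n=0\}\cap\overline{E(I_S)}\right\}.$$ -}

module Defs where

open import Level using (0ℓ)
open import Data.Fin using (Fin; toℕ; cast; _↑ʳ_)
open import Data.Integer as ℤ using (ℤ; +_)
open import Data.List as List using (List; []; _∷_; _++_)
open import Data.Nat as ℕ using (ℕ; zero; suc; _∸_; _≤_)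
open import Data.Nat.Properties as ℕₚ using (m∸n+n≡m)
open import Data.Product using (Σ; ∃-syntax; _×_; _,_)
open import Data.Rational as ℚ using (ℚ; 0ℚ; 1ℚ)
open import Data.Rational.Properties as ℚₚ using ()
open import Data.Sum using (_⊎_)
open import Data.Vec as Vec using (Vec; lookup; tabulate; replicate; zipWith; take; drop; _[_]≔_)
open import Data.Vec.Functional as Vector using (Vector)
open import Data.Vec.Properties using (≡-dec)
open import Data.Bool using (if_then_else_)
open import Function using (_∘_)
open import Induction.WellFounded using (WellFounded)
open import Relation.Binary using (Rel; IsStrictTotalOrder)
open import Relation.Binary.Construct.Closure.ReflexiveTransitive using (Star)
open import Relation.Binary.PropositionalEquality using (_≡_; _≢_)
open import Relation.Nullary using (does)
open import Relation.Unary using (Pred; _∈_; _∉_)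

open import Algebra.Properties.CommutativeMonoid.Sum ℕₚ.+-0-commutativeMonoid
  using () renaming (sum to sumℕ)
open import Algebra.Properties.CommutativeMonoid.Sum ℚₚ.+-0-commutativeMonoid
  using () renaming (sum to sumℚ)

Exponent : ℕ → Set
Exponent n = Vec ℕ n

infixl 6 _⊕_
_⊕_ : ∀ {n} → Exponent n → Exponent n → Exponent n
_⊕_ = zipWith ℕ._+_

𝟎 : ∀ {n} → Exponent n
𝟎 = replicate _ 0

record IsMonomialOrdering {n} (_≺_ : Rel (Exponent n) 0ℓ) : Set where
  field
    isStrictTotalOrder : IsStrictTotalOrder _≡_ _≺_
    compatible         : ∀ {u v} w → u ≺ v → (u ⊕ w) ≺ (v ⊕ w)
    wellFounded        : WellFounded _≺_

-- A polynomial is a formal sum of terms, in which exponents may repeat and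
-- coefficients may vanish; it is only meaningful up to _≈_.

Poly : ℕ → Set
Poly n = List (ℚ × Exponent n)

coeff : ∀ {n} → Poly n → Exponent n → ℚ
coeff []            m = 0ℚ
coeff ((c , u) ∷ f) m =
  (if does (≡-dec ℕ._≟_ u m) then c else 0ℚ) ℚ.+ coeff f m

infix 4 _≈_
_≈_ : ∀ {n} → Rel (Poly n) 0ℓ
f ≈ g = ∀ m → coeff f m ≡ coeff g m

0ₚ : ∀ {n} → Poly n
0ₚ = []

term : ∀ {n} → ℚ → Exponent n → Poly n
term c u = (c , u) ∷ []

monomial : ∀ {n} → Exponent n → Poly n
monomial = term 1ℚ

1ₚ : ∀ {n} → Poly n
1ₚ = monomial 𝟎

var : ∀ {n} → Fin n → Poly n
var i = monomial (𝟎 [ i ]≔ 1)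

infixl 6 _+ₚ_ _-ₚ_
infixl 7 _*ₚ_
infixr 8 _^ₚ_

_+ₚ_ : ∀ {n} → Poly n → Poly n → Poly n
_+ₚ_ = _++_

-ₚ_ : ∀ {n} → Poly n → Poly n
-ₚ_ = List.map λ (c , u) → (ℚ.- c , u)

_-ₚ_ : ∀ {n} → Poly n → Poly n → Poly n
f -ₚ g = f +ₚ (-ₚ g)

_*ₚ_ : ∀ {n} → Poly n → Poly n → Poly n
[]            *ₚ g = 0ₚ
((c , u) ∷ f) *ₚ g = List.map (λ (c′ , u′) → (c ℚ.* c′ , u ⊕ u′)) g +ₚ f *ₚ g

_^ₚ_ : ∀ {n} → Poly n → ℕ → Poly n
f ^ₚ zero  = 1ₚ
f ^ₚ suc e = f *ₚ f ^ₚ e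

-- The ℚ-algebra homomorphism sending the i-th variable to σ i.
substitute : ∀ {m n} → Vector (Poly n) m → Poly m → Poly n
substitute σ []            = 0ₚ
substitute σ ((c , u) ∷ f) =
  term c 𝟎 *ₚ Vector.foldr _*ₚ_ 1ₚ (λ i → σ i ^ₚ lookup u i) +ₚ substitute σ f

module _ {n} (_≺_ : Rel (Exponent n) 0ℓ) where

  -- exp(f) = e; in particular f is nonzero.
  HasExp : Poly n → Exponent n → Set
  HasExp f e = coeff f e ≢ 0ℚ × (∀ m → coeff f m ≢ 0ℚ → m ≢ e → m ≺ e)

  -- ⋃ { exp(g) + ℕⁿ ∣ g ∈ B }
  E : ∀ {r} → Vector (Poly n) r → Pred (Exponent n) 0ℓ
  E B m = ∃[ i ] ∃[ e ] ∃[ w ] HasExp (B i) e × m ≡ e ⊕ w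

  record IsGroebnerBasis (I : Pred (Poly n) 0ℓ) {r} (B : Vector (Poly n) r) : Set where
    field
      inIdeal  : ∀ i → B i ∈ I
      leading  : ∀ f e → f ∈ I → HasExp f e → e ∈ E B

  record IsReducedGroebnerBasis (I : Pred (Poly n) 0ℓ) {r} (B : Vector (Poly n) r) : Set where
    field
      isGroebnerBasis : IsGroebnerBasis I B
      monic           : ∀ i → ∃[ e ] HasExp (B i) e × coeff (B i) e ≡ 1ℚ
      reduced         : ∀ i j → i ≢ j → ∀ m e w → coeff (B i) m ≢ 0ℚ →
                        HasExp (B j) e → m ≢ e ⊕ w

  -- One reduction step: a term of f, at a multiple of some exp(B i), is
  -- cancelled by subtracting a multiple of B i.
  Reduces : ∀ {r} → Vector (Poly n) r → Rel (Poly n) 0ℓ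
  Reduces B f f′ =
    ∃[ i ] ∃[ e ] ∃[ w ] ∃[ c ]
      HasExp (B i) e ×
      coeff f (w ⊕ e) ≢ 0ℚ ×
      c ℚ.* coeff (B i) e ≡ coeff f (w ⊕ e) ×
      f′ ≈ f -ₚ term c w *ₚ B i

  IsNormalForm : ∀ {r} → Vector (Poly n) r → Poly n → Poly n → Set
  IsNormalForm B f h =
    Star (Reduces B) f h × (∀ m → coeff h m ≢ 0ℚ → m ∉ E B)

combination : ∀ {d k} → Vector (Exponent d) k → Exponent k → Exponent d
combination a u = tabulate λ c → sumℕ λ j → lookup u j ℕ.* lookup (a j) c

-- The monoid ⟨a₁,…,aₖ⟩ as a subset of ℤᵈ, so that differences of
-- exponent vectors can be tested for membership.
Monoid⟨_⟩ : ∀ {d k} → Vector (Exponent d) k → Pred (Vec ℤ d) 0ℓ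
Monoid⟨ a ⟩ v = ∃[ u ] v ≡ Vec.map +_ (combination a u)

pos : ∀ {d m} → Vector (Exponent d) m → Pred (Vec ℚ d) 0ℓ
pos {m = m} b v =
  Σ (Vector ℚ m) λ c →
    (∀ i → 0ℚ ℚ.≤ c i) ×
    v ≡ tabulate (λ l → sumℚ λ i → c i ℚ.* ((+ lookup (b i) l) ℚ./ 1))

Ap : ∀ {d k n} → Vector (Exponent d) k → Vector (Exponent d) n → Pred (Exponent d) 0ℓ
Ap a b x =
  Vec.map +_ x ∈ Monoid⟨ a ⟩ ×
  (∀ i → zipWith ℤ._-_ (Vec.map +_ x) (Vec.map +_ (b i)) ∉ Monoid⟨ a ⟩)

-- The i-th of the last n among k indices.
last : ∀ {k n} → n ≤ k → Fin n → Fin k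
last {k} {n} n≤k i = cast (m∸n+n≡m n≤k) ((k ∸ n) ↑ʳ i)

Λ : ∀ {d k n} → n ≤ k → Vector (Exponent d) k → Vector (Exponent d) n
Λ n≤k a = a ∘ last n≤k

-- The variables of ℚ[x,y] are x₁,…,x_d followed by y₁,…,y_k.  This is the
-- kernel of the homomorphism fixing each x_i and sending y_j to x^(a j).
I[_] : ∀ {d k} → Vector (Exponent d) k → Pred (Poly (d ℕ.+ k)) 0ℓ
I[ a ] f = substitute (var Vector.++ (monomial ∘ a)) f ≈ 0ₚ

-- i ◁ j says that the variable y_i is smaller than y_j.
RevLex : ∀ {k} → Rel (Fin k) 0ℓ → Rel (Exponent k) 0ℓ
RevLex _◁_ u v =
  ∃[ j ] lookup v j ℕ.< lookup u j × (∀ i → i ◁ j → lookup u i ≡ lookup v i)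

GradedRevLex : ∀ {d k} → Vector (Exponent d) k →
               Rel (Exponent d) 0ℓ → Rel (Fin k) 0ℓ → Rel (Exponent k) 0ℓ
GradedRevLex a _≺deg_ _◁_ u v =
  combination a u ≺deg combination a v ⊎
  (combination a u ≡ combination a v × RevLex _◁_ u v)

Block : ∀ {d k} → Rel (Exponent d) 0ℓ → Rel (Exponent k) 0ℓ → Rel (Exponent (d ℕ.+ k)) 0ℓ
Block {d} _≺x_ _≺y_ u v =
  take d u ≺x take d v ⊎ (take d u ≡ take d v × drop d u ≺y drop d v)

-- n is the number of variables z, the last n of the variables y.
Q : ∀ {d k n r} → n ≤ k → Rel (Exponent (d ℕ.+ k)) 0ℓ →
    Vector (Poly (d ℕ.+ k)) r → Pred (Exponent d) 0ℓ
Q {d} {k} n≤k _≺_ B x =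
  ∃[ h ] ∃[ e ]
    IsNormalForm _≺_ B (monomial (x Vec.++ 𝟎)) h ×
    HasExp _≺_ h e ×
    take d e ≡ 𝟎 ×
    (∀ i → lookup (drop d e) (last n≤k i) ≡ 0) ×
    e ∉ E _≺_ B

{-# OPTIONS --safe #-}
-- Sending a monomial to its degree in ℤ^d (with deg x_i = e_i, deg y_j = a_j),
-- I_S consists of the polynomials whose image under degree vanishes.  It
-- contains the difference of any two monomials of the same degree, so a monomial
-- outside E(I_S) is the least one of its degree.  Hence the tail of an element of
-- the reduced basis has terms of pairwise distinct degrees, which forces the basis
-- to consist of binomials; reduction preserves degrees, and the normal form of x^a
-- is the least monomial of degree a.  If a ∈ S, this monomial is free of x since
-- some y^u has degree a; and since the z are the smallest variables, the graded
-- reverse lexicographic order makes it divisible by some z_i as soon as any y^u of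
-- degree a is, that is, as soon as a − b ∈ S for some b ∈ Λ.
module Submission where

open import Defs
open import Level using (0ℓ)
open import Data.Nat using (ℕ; _+_; _∸_; _≤_; _<_)
open import Data.Fin using (Fin; toℕ)
open import Data.Vec.Functional using (Vector)
open import Relation.Binary using (Rel; IsStrictTotalOrder)
open import Relation.Binary.PropositionalEquality using (_≡_; _≢_)
open import Relation.Unary using (_≐_)

open import Algebra.Bundles using (CommutativeMonoid)
open import Algebra.Structures using (IsCommutativeMonoid)
import Algebra.Properties.AbelianGroup as AbelianGroupProperties
import Algebra.Properties.CommutativeMonoid.Sum as CommutativeMonoidSum
import Algebra.Properties.Monoid.Mult as MonoidMult
import Algebra.Properties.CommutativeSemigroup as CommutativeSemigroupProperties
open import Data.Bool using (if_then_else_)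
open import Data.Fin as Fin using (zero; suc; cast; _↑ˡ_; _↑ʳ_; fromℕ<; finToFun; funToFin)
open import Data.Fin.Induction using (spo-wellFounded)
import Data.Fin.Properties as Finₚ
open import Data.Integer as ℤ using (ℤ)
import Data.Integer.Properties as ℤₚ
open import Data.List as List using ([]; _∷_; length; filter)
import Data.List.Properties as Listₚ
open import Data.List.Relation.Unary.Any as Any using (Any; here; there)
open import Data.Nat as ℕ using (zero; suc; _*_; z≤n; s≤s)
import Data.Nat.Properties as ℕₚ
open import Data.Product using (∃-syntax; _×_; _,_; proj₁; proj₂)
open import Data.Product.Relation.Binary.Lex.Strict using (×-wellFounded)
open import Data.Rational as ℚ using (ℚ; 0ℚ; 1ℚ)
import Data.Rational.Properties as ℚₚ
open import Data.Sum using (_⊎_; inj₁; inj₂)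
open import Data.Vec as Vec using (Vec; []; _∷_; lookup; tabulate; take; drop; zipWith; _[_]≔_)
import Data.Vec.Functional as Vector
import Data.Vec.Properties as Vecₚ
open import Function using (_∘_; _on_; case_of_)
open import Induction.WellFounded
  using (WellFounded; Acc; acc; wf⇒asym; module Subrelation)
open import Relation.Binary using (IsStrictPartialOrder; tri<; tri≈; tri>)
import Relation.Binary.Construct.On as On
open import Relation.Binary.Construct.Closure.ReflexiveTransitive using (Star; ε; _◅_)
open import Relation.Binary.PropositionalEquality
  using (refl; sym; trans; cong; cong₂; subst; subst₂; isEquivalence; module ≡-Reasoning)
open import Relation.Nullary using (¬_; Dec; yes; no; does; contradiction; ¬?)
open import Relation.Nullary.Decidable using (_×-dec_; map′; decidable-stable; dec-true; dec-false)
open import Relation.Unary using (Pred; Decidable; _∈_; _∉_)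

private
  variable
    d k m n r : ℕ

  module Sumℕ = CommutativeMonoidSum ℕₚ.+-0-commutativeMonoid
  open Sumℕ using () renaming (sum to sumℕ)

  module ℚ-+ = CommutativeSemigroupProperties
    (CommutativeMonoid.commutativeSemigroup ℚₚ.+-0-commutativeMonoid)

-- Exponent vectors

infix 4 _≟ₑ_
_≟ₑ_ : (u v : Exponent n) → Dec (u ≡ v)
_≟ₑ_ = Vecₚ.≡-dec ℕ._≟_

lookup-injective : ∀ {A : Set} {u v : Vec A n} → (∀ i → lookup u i ≡ lookup v i) → u ≡ v
lookup-injective {u = u} {v} eq =
  trans (sym (Vecₚ.tabulate∘lookup u)) (trans (Vecₚ.tabulate-cong eq) (Vecₚ.tabulate∘lookup v))

⊕-𝟎-isCommutativeMonoid : IsCommutativeMonoid _≡_ (_⊕_ {n}) 𝟎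
⊕-𝟎-isCommutativeMonoid = record
  { isMonoid = record
    { isSemigroup = record
      { isMagma = record { isEquivalence = isEquivalence ; ∙-cong = cong₂ _⊕_ }
      ; assoc   = Vecₚ.zipWith-assoc ℕₚ.+-assoc
      }
    ; identity = Vecₚ.zipWith-identityˡ ℕₚ.+-identityˡ , Vecₚ.zipWith-identityʳ ℕₚ.+-identityʳ
    }
  ; comm = Vecₚ.zipWith-comm ℕₚ.+-comm
  }

⊕-𝟎-commutativeMonoid : ℕ → CommutativeMonoid 0ℓ 0ℓ
⊕-𝟎-commutativeMonoid n = record { isCommutativeMonoid = ⊕-𝟎-isCommutativeMonoid {n} }

module ⊕ {n : ℕ} where
  open CommutativeMonoid (⊕-𝟎-commutativeMonoid n) public
    using (assoc; comm; identityˡ; identityʳ)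
  open MonoidMult (CommutativeMonoid.monoid (⊕-𝟎-commutativeMonoid n)) public
    using () renaming (_×_ to _·_)
  open CommutativeMonoidSum (⊕-𝟎-commutativeMonoid n) public using (sum)
  open CommutativeSemigroupProperties
    (CommutativeMonoid.commutativeSemigroup (⊕-𝟎-commutativeMonoid n)) public
    using (interchange)

⊕-cancelˡ : (w : Exponent n) {u v : Exponent n} → w ⊕ u ≡ w ⊕ v → u ≡ v
⊕-cancelˡ w {u} {v} eq = lookup-injective λ i →
  ℕₚ.+-cancelˡ-≡ (lookup w i) _ _
    (trans (sym (Vecₚ.lookup-zipWith _ i w u))
      (trans (cong (λ z → lookup z i) eq) (Vecₚ.lookup-zipWith _ i w v)))

⊕-∸ : (e w : Exponent n) → zipWith _∸_ (e ⊕ w) e ≡ w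
⊕-∸ []      []      = refl
⊕-∸ (x ∷ e) (y ∷ w) = cong₂ _∷_ (ℕₚ.m+n∸m≡n x y) (⊕-∸ e w)

-- A counterexample would give the infinite descent `e`, `e ⊕ w`, `e ⊕ w ⊕ w`, and so on.
⊕-⊀ : {_≺_ : Rel (Exponent n) 0ℓ} → WellFounded _≺_ →
      (∀ w {u v} → u ≺ v → (w ⊕ u) ≺ (w ⊕ v)) → ∀ e w → ¬ ((e ⊕ w) ≺ e)
⊕-⊀ {_≺_ = _≺_} wf ≺-⊕ˡ e w = go e (wf e)
  where
  go : ∀ e → Acc _≺_ e → ¬ ((e ⊕ w) ≺ e)
  go e (acc rs) lt = go (e ⊕ w) (rs lt)
    (subst₂ _≺_ (⊕.comm w (e ⊕ w)) (⊕.comm w e) (≺-⊕ˡ w lt))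

monomialOrdering-⊕ˡ : {_≺_ : Rel (Exponent n) 0ℓ} → IsMonomialOrdering _≺_ →
                      ∀ w {u v} → u ≺ v → (w ⊕ u) ≺ (w ⊕ v)
monomialOrdering-⊕ˡ {_≺_ = _≺_} ord w {u} {v} lt =
  subst₂ _≺_ (⊕.comm u w) (⊕.comm v w) (IsMonomialOrdering.compatible ord w lt)

-- The truncated difference is the only possible cofactor, so one equality test decides
-- divisibility.
_multipleOf?_ : (u e : Exponent n) → Dec (∃[ w ] u ≡ e ⊕ w)
u multipleOf? e = map′ (_ ,_) to (u ≟ₑ e ⊕ zipWith _∸_ u e)
  where
  to : ∃[ w ] u ≡ e ⊕ w → u ≡ e ⊕ zipWith _∸_ u e
  to (w , refl) = cong (e ⊕_) (sym (⊕-∸ e w))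

take-++ : ∀ {A : Set} (u : Vec A m) (v : Vec A n) → take m (u Vec.++ v) ≡ u
take-++ {m = m} u v = proj₁ (Vecₚ.++-injective (take m (u Vec.++ v)) u (Vecₚ.take++drop≡id m (u Vec.++ v)))

drop-++ : ∀ {A : Set} (u : Vec A m) (v : Vec A n) → drop m (u Vec.++ v) ≡ v
drop-++ {m = m} u v = proj₂ (Vecₚ.++-injective (take m (u Vec.++ v)) u (Vecₚ.take++drop≡id m (u Vec.++ v)))

unit : Fin n → Exponent n
unit i = 𝟎 [ i ]≔ 1

-- Weighted degrees

sumℕ-++ : ∀ m (f : Fin (m + n) → ℕ) → sumℕ f ≡ sumℕ (f ∘ (_↑ˡ n)) + sumℕ (f ∘ (m ↑ʳ_))
sumℕ-++ zero    f = refl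
sumℕ-++ (suc m) f =
  trans (cong (f zero +_) (sumℕ-++ m (f ∘ suc))) (sym (ℕₚ.+-assoc (f zero) _ _))

sumℕ-zero : (f : Vector ℕ n) → (∀ i → f i ≡ 0) → sumℕ f ≡ 0
sumℕ-zero {n} f eq = trans (Sumℕ.sum-cong-≗ eq) (Sumℕ.sum-replicate-zero n)

≤-sumℕ : (f : Vector ℕ n) (i : Fin n) → f i ≤ sumℕ f
≤-sumℕ f zero    = ℕₚ.m≤m+n _ _
≤-sumℕ f (suc i) = ℕₚ.≤-trans (≤-sumℕ (f ∘ suc) i) (ℕₚ.m≤n+m _ (f zero))

lookup≤sum : (v : Exponent n) (i : Fin n) → lookup v i ≤ Vec.sum v
lookup≤sum (x ∷ v) zero    = ℕₚ.m≤m+n x _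
lookup≤sum (x ∷ v) (suc i) = ℕₚ.≤-trans (lookup≤sum v i) (ℕₚ.m≤n+m _ x)

lookup-combination : (a : Vector (Exponent d) k) (u : Exponent k) (c : Fin d) →
                     lookup (combination a u) c ≡ sumℕ λ j → lookup u j * lookup (a j) c
lookup-combination a u c = Vecₚ.lookup∘tabulate _ c

combination-⊕ : (a : Vector (Exponent d) k) (u v : Exponent k) →
                combination a (u ⊕ v) ≡ combination a u ⊕ combination a v
combination-⊕ a u v = lookup-injective λ c → begin
  lookup (combination a (u ⊕ v)) c
    ≡⟨ lookup-combination a (u ⊕ v) c ⟩
  (sumℕ λ j → lookup (u ⊕ v) j * lookup (a j) c)
    ≡⟨ Sumℕ.sum-cong-≗ (λ j → trans (cong (_* lookup (a j) c) (Vecₚ.lookup-zipWith _ j u v))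
                              (ℕₚ.*-distribʳ-+ (lookup (a j) c) (lookup u j) (lookup v j))) ⟩
  (sumℕ λ j → lookup u j * lookup (a j) c + lookup v j * lookup (a j) c)
    ≡⟨ Sumℕ.∑-distrib-+ (λ j → lookup u j * lookup (a j) c) (λ j → lookup v j * lookup (a j) c) ⟩
  (sumℕ λ j → lookup u j * lookup (a j) c) + (sumℕ λ j → lookup v j * lookup (a j) c)
    ≡⟨ cong₂ _+_ (lookup-combination a u c) (lookup-combination a v c) ⟨
  lookup (combination a u) c + lookup (combination a v) c
    ≡⟨ Vecₚ.lookup-zipWith _ c (combination a u) (combination a v) ⟨
  lookup (combination a u ⊕ combination a v) c ∎
  where open ≡-Reasoning

combination-𝟎 : (a : Vector (Exponent d) k) → combination a 𝟎 ≡ 𝟎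
combination-𝟎 a = lookup-injective λ c → trans (lookup-combination a 𝟎 c)
  (trans (sumℕ-zero _ λ j → cong (_* lookup (a j) c) (Vecₚ.lookup-replicate j 0))
    (sym (Vecₚ.lookup-replicate c 0)))

sumℕ-unit : (i : Fin n) (f : Vector ℕ n) → (sumℕ λ j → lookup (unit i) j * f j) ≡ f i
sumℕ-unit zero    f = trans
  (cong₂ _+_ (ℕₚ.+-identityʳ (f zero))
    (sumℕ-zero _ λ j → cong (_* f (suc j)) (Vecₚ.lookup-replicate j 0)))
  (ℕₚ.+-identityʳ (f zero))
sumℕ-unit (suc i) f = sumℕ-unit i (f ∘ suc)

combination-unit : (a : Vector (Exponent d) k) (i : Fin k) → combination a (unit i) ≡ a i
combination-unit a i = lookup-injective λ c →
  trans (lookup-combination a (unit i) c) (sumℕ-unit i _)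

-- Symmetry of the identity matrix; it brings the sum in `combination-units` into the shape that
-- `sumℕ-unit` evaluates.
lookup-unit-sym : (i j : Fin n) → lookup (unit i) j ≡ lookup (unit j) i
lookup-unit-sym i j with i Fin.≟ j
... | yes refl = refl
... | no i≢j   = trans
  (trans (Vecₚ.lookup∘update′ (i≢j ∘ sym) 𝟎 1) (Vecₚ.lookup-replicate j 0))
  (sym (trans (Vecₚ.lookup∘update′ i≢j 𝟎 1) (Vecₚ.lookup-replicate i 0)))

combination-units : (u : Exponent n) → combination unit u ≡ u
combination-units u = lookup-injective λ c → trans (lookup-combination unit u c)
  (trans (Sumℕ.sum-cong-≗ λ j →
           trans (ℕₚ.*-comm (lookup u j) _) (cong (_* lookup u j) (lookup-unit-sym j c)))
    (sumℕ-unit c (lookup u)))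

combination-++ : (b : Vector (Exponent d) m) (a : Vector (Exponent d) k) (u : Exponent (m + k)) →
  combination (b Vector.++ a) u ≡ combination b (take m u) ⊕ combination a (drop m u)
combination-++ {m = m} {k = k} b a u = lookup-injective λ c → begin
  lookup (combination (b Vector.++ a) u) c
    ≡⟨ lookup-combination (b Vector.++ a) u c ⟩
  (sumℕ λ j → lookup u j * lookup ((b Vector.++ a) j) c)
    ≡⟨ sumℕ-++ m (λ j → lookup u j * lookup ((b Vector.++ a) j) c) ⟩
  (sumℕ λ j → lookup u (j ↑ˡ k) * lookup ((b Vector.++ a) (j ↑ˡ k)) c) +
  (sumℕ λ j → lookup u (m ↑ʳ j) * lookup ((b Vector.++ a) (m ↑ʳ j)) c)
    ≡⟨ cong₂ _+_
         (Sumℕ.sum-cong-≗ λ j → cong₂ (λ x y → x * lookup y c) (lookupˡ j) (cong-splitˡ j))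
         (Sumℕ.sum-cong-≗ λ j → cong₂ (λ x y → x * lookup y c) (lookupʳ j) (cong-splitʳ j)) ⟩
  (sumℕ λ j → lookup (take m u) j * lookup (b j) c) +
  (sumℕ λ j → lookup (drop m u) j * lookup (a j) c)
    ≡⟨ cong₂ _+_ (lookup-combination b (take m u) c) (lookup-combination a (drop m u) c) ⟨
  lookup (combination b (take m u)) c + lookup (combination a (drop m u)) c
    ≡⟨ Vecₚ.lookup-zipWith _ c (combination b (take m u)) (combination a (drop m u)) ⟨
  lookup (combination b (take m u) ⊕ combination a (drop m u)) c ∎
  where
  open ≡-Reasoning
  lookupˡ : ∀ j → lookup u (j ↑ˡ k) ≡ lookup (take m u) j
  lookupˡ j = trans (cong (λ v → lookup v (j ↑ˡ k)) (sym (Vecₚ.take++drop≡id m u)))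
    (Vecₚ.lookup-++ˡ (take m u) (drop m u) j)
  lookupʳ : ∀ j → lookup u (m ↑ʳ j) ≡ lookup (drop m u) j
  lookupʳ j = trans (cong (λ v → lookup v (m ↑ʳ j)) (sym (Vecₚ.take++drop≡id m u)))
    (Vecₚ.lookup-++ʳ (take m u) (drop m u) j)
  cong-splitˡ : ∀ j → (b Vector.++ a) (j ↑ˡ k) ≡ b j
  cong-splitˡ j rewrite Finₚ.splitAt-↑ˡ m j k = refl
  cong-splitʳ : ∀ j → (b Vector.++ a) (m ↑ʳ j) ≡ a j
  cong-splitʳ j rewrite Finₚ.splitAt-↑ʳ m k j = refl

lookup-· : (x : ℕ) (p : Exponent n) (c : Fin n) → lookup (x ⊕.· p) c ≡ x * lookup p c
lookup-· zero    p c = Vecₚ.lookup-replicate c 0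
lookup-· (suc x) p c = trans (Vecₚ.lookup-zipWith _ c p (x ⊕.· p)) (cong (lookup p c +_) (lookup-· x p c))

lookup-sum : (f : Vector (Exponent d) k) (c : Fin d) →
             lookup (⊕.sum f) c ≡ sumℕ λ j → lookup (f j) c
lookup-sum {k = zero}  f c = Vecₚ.lookup-replicate c 0
lookup-sum {k = suc k} f c = trans (Vecₚ.lookup-zipWith _ c (f zero) (⊕.sum (f ∘ suc)))
  (cong (lookup (f zero) c +_) (lookup-sum (f ∘ suc) c))

sum-·≡combination : (a : Vector (Exponent d) k) (u : Exponent k) →
                    (⊕.sum λ j → lookup u j ⊕.· a j) ≡ combination a u
sum-·≡combination a u = lookup-injective λ c → trans (lookup-sum (λ j → lookup u j ⊕.· a j) c)
  (trans (Sumℕ.sum-cong-≗ λ j → lookup-· (lookup u j) (a j) c)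
    (sym (lookup-combination a u c)))

-- Some coordinate of `a j` is at least 1, so the same coordinate of the combination dominates
-- `lookup u j`. Hence only finitely many exponents share a given combination.
lookup≤sum-combination : (a : Vector (Exponent d) k) → (∀ j → a j ≢ 𝟎) →
  ∀ u j → lookup u j ≤ Vec.sum (combination a u)
lookup≤sum-combination a a≢𝟎 u j with Finₚ.any? (λ c → ¬? (lookup (a j) c ℕ.≟ 0))
... | no none = contradiction
        (lookup-injective λ c → trans
          (decidable-stable (lookup (a j) c ℕ.≟ 0) λ ≢0 → none (c , ≢0))
          (sym (Vecₚ.lookup-replicate c 0)))
        (a≢𝟎 j)
... | yes (c , ajc≢0) = begin
  lookup u j                                  ≤⟨ ℕₚ.m≤m*n (lookup u j) (lookup (a j) c) ⟩
  lookup u j * lookup (a j) c                 ≤⟨ ≤-sumℕ (λ i → lookup u i * lookup (a i) c) j ⟩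
  (sumℕ λ i → lookup u i * lookup (a i) c)    ≡⟨ lookup-combination a u c ⟨
  lookup (combination a u) c                  ≤⟨ lookup≤sum (combination a u) c ⟩
  Vec.sum (combination a u)                   ∎
  where
  open ℕₚ.≤-Reasoning
  instance _ = ℕ.≢-nonZero ajc≢0

-- Linear functionals on polynomials

-- Linear extension of `φ` from monomials to formal sums. Single coefficients, sums of coefficients
-- over one degree and the sum of all coefficients are instances.
lin : (Exponent n → ℚ) → Poly n → ℚ
lin φ []            = 0ℚ
lin φ ((c , u) ∷ f) = c ℚ.* φ u ℚ.+ lin φ f

δ : Exponent n → Exponent n → ℚ
δ s u = if does (u ≟ₑ s) then 1ℚ else 0ℚ

δ-≡ : {s u : Exponent n} → u ≡ s → δ s u ≡ 1ℚ
δ-≡ {s = s} {u} eq rewrite dec-true (u ≟ₑ s) eq = refl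

δ-≢ : {s u : Exponent n} → u ≢ s → δ s u ≡ 0ℚ
δ-≢ {s = s} {u} neq rewrite dec-false (u ≟ₑ s) neq = refl

coeff≡lin-δ : (f : Poly n) (s : Exponent n) → coeff f s ≡ lin (δ s) f
coeff≡lin-δ []            s = refl
coeff≡lin-δ ((c , u) ∷ f) s = cong₂ ℚ._+_ (head u) (coeff≡lin-δ f s)
  where
  head : ∀ u → (if does (u ≟ₑ s) then c else 0ℚ) ≡ c ℚ.* δ s u
  head u with u ≟ₑ s
  ... | yes _ = sym (ℚₚ.*-identityʳ c)
  ... | no  _ = sym (ℚₚ.*-zeroʳ c)

lin-cong : {φ ψ : Exponent n → ℚ} → (∀ u → φ u ≡ ψ u) → ∀ f → lin φ f ≡ lin ψ f
lin-cong eq []            = refl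
lin-cong eq ((c , u) ∷ f) = cong₂ (λ x y → c ℚ.* x ℚ.+ y) (eq u) (lin-cong eq f)

lin-+ₚ : (φ : Exponent n → ℚ) (f g : Poly n) → lin φ (f +ₚ g) ≡ lin φ f ℚ.+ lin φ g
lin-+ₚ φ []            g = sym (ℚₚ.+-identityˡ _)
lin-+ₚ φ ((c , u) ∷ f) g =
  trans (cong (c ℚ.* φ u ℚ.+_) (lin-+ₚ φ f g)) (sym (ℚₚ.+-assoc (c ℚ.* φ u) _ _))

lin--ₚ : (φ : Exponent n → ℚ) (f : Poly n) → lin φ (-ₚ f) ≡ ℚ.- lin φ f
lin--ₚ φ []            = refl
lin--ₚ φ ((c , u) ∷ f) = trans
  (cong₂ ℚ._+_ (sym (ℚₚ.neg-distribˡ-* c (φ u))) (lin--ₚ φ f))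
  (sym (ℚₚ.neg-distrib-+ (c ℚ.* φ u) (lin φ f)))

lin-minus : (φ : Exponent n → ℚ) (f g : Poly n) → lin φ (f -ₚ g) ≡ lin φ f ℚ.- lin φ g
lin-minus φ f g = trans (lin-+ₚ φ f (-ₚ g)) (cong (lin φ f ℚ.+_) (lin--ₚ φ g))

coeff-minus : (f g : Poly n) (s : Exponent n) → coeff (f -ₚ g) s ≡ coeff f s ℚ.- coeff g s
coeff-minus f g s = trans (coeff≡lin-δ (f -ₚ g) s) (trans (lin-minus (δ s) f g)
  (sym (cong₂ ℚ._-_ (coeff≡lin-δ f s) (coeff≡lin-δ g s))))

lin-monomial : (φ : Exponent n → ℚ) (u : Exponent n) → lin φ (monomial u) ≡ φ u
lin-monomial φ u = trans (ℚₚ.+-identityʳ (1ℚ ℚ.* φ u)) (ℚₚ.*-identityˡ (φ u))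

lin-term-*ₚ : (φ : Exponent n → ℚ) (c : ℚ) (w : Exponent n) (f : Poly n) →
              lin φ (term c w *ₚ f) ≡ c ℚ.* lin (φ ∘ (w ⊕_)) f
lin-term-*ₚ φ c w []             = sym (ℚₚ.*-zeroʳ c)
lin-term-*ₚ φ c w ((c′ , u) ∷ f) = trans
  (cong₂ ℚ._+_ (ℚₚ.*-assoc c c′ (φ (w ⊕ u))) (lin-term-*ₚ φ c w f))
  (sym (ℚₚ.*-distribˡ-+ c (c′ ℚ.* φ (w ⊕ u)) _))

lin-*ʳ : (φ : Exponent n → ℚ) (c : ℚ) (f : Poly n) → lin (λ u → φ u ℚ.* c) f ≡ lin φ f ℚ.* c
lin-*ʳ φ c []             = sym (ℚₚ.*-zeroˡ c)
lin-*ʳ φ c ((c′ , u) ∷ f) = trans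
  (cong₂ ℚ._+_ (sym (ℚₚ.*-assoc c′ (φ u) c)) (lin-*ʳ φ c f))
  (sym (ℚₚ.*-distribʳ-+ c (c′ ℚ.* φ u) _))

lin-sum : (φ ψ : Exponent n → ℚ) (f : Poly n) →
          lin (λ u → φ u ℚ.+ ψ u) f ≡ lin φ f ℚ.+ lin ψ f
lin-sum φ ψ []            = refl
lin-sum φ ψ ((c , u) ∷ f) = trans
  (cong₂ ℚ._+_ (ℚₚ.*-distribˡ-+ c (φ u) (ψ u)) (lin-sum φ ψ f))
  (ℚ-+.interchange (c ℚ.* φ u) (c ℚ.* ψ u) (lin φ f) (lin ψ f))

-- Collecting terms of equal exponent.

remove : Exponent n → Poly n → Poly n
remove u = filter λ t → ¬? (proj₂ t ≟ₑ u)

coeff-≢ : (c : ℚ) (f : Poly n) {u v : Exponent n} → u ≢ v → coeff ((c , u) ∷ f) v ≡ coeff f v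
coeff-≢ c f {u} {v} u≢v rewrite dec-false (u ≟ₑ v) u≢v = ℚₚ.+-identityˡ (coeff f v)

coeff-≡ : (c : ℚ) (f : Poly n) (u : Exponent n) → coeff ((c , u) ∷ f) u ≡ c ℚ.+ coeff f u
coeff-≡ c f u rewrite dec-true (u ≟ₑ u) refl = refl

coeff-remove-≡ : (u : Exponent n) (f : Poly n) → coeff (remove u f) u ≡ 0ℚ
coeff-remove-≡ u []            = refl
coeff-remove-≡ u ((c , v) ∷ f) with v ≟ₑ u
... | yes _  = coeff-remove-≡ u f
... | no v≢u = trans (coeff-≢ c (remove u f) v≢u) (coeff-remove-≡ u f)

coeff-remove-≢ : {u v : Exponent n} → u ≢ v → (f : Poly n) → coeff (remove u f) v ≡ coeff f v
coeff-remove-≢         u≢v []            = refl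
coeff-remove-≢ {u = u} {v} u≢v ((c , v′) ∷ f) with v′ ≟ₑ u
... | yes refl = trans (coeff-remove-≢ u≢v f) (sym (coeff-≢ c f u≢v))
... | no _     = cong ((if does (v′ ≟ₑ v) then c else 0ℚ) ℚ.+_) (coeff-remove-≢ u≢v f)

lin-remove : (φ : Exponent n → ℚ) (u : Exponent n) (f : Poly n) →
             lin φ f ≡ coeff f u ℚ.* φ u ℚ.+ lin φ (remove u f)
lin-remove φ u []            = sym (trans (ℚₚ.+-identityʳ _) (ℚₚ.*-zeroˡ (φ u)))
lin-remove φ u ((c , v) ∷ f) with v ≟ₑ u
... | yes refl = begin
  c ℚ.* φ u ℚ.+ lin φ f                                       ≡⟨ cong (c ℚ.* φ u ℚ.+_) (lin-remove φ u f) ⟩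
  c ℚ.* φ u ℚ.+ (coeff f u ℚ.* φ u ℚ.+ lin φ (remove u f))    ≡⟨ ℚₚ.+-assoc (c ℚ.* φ u) _ _ ⟨
  c ℚ.* φ u ℚ.+ coeff f u ℚ.* φ u ℚ.+ lin φ (remove u f)
    ≡⟨ cong (ℚ._+ lin φ (remove u f)) (ℚₚ.*-distribʳ-+ (φ u) c (coeff f u)) ⟨
  (c ℚ.+ coeff f u) ℚ.* φ u ℚ.+ lin φ (remove u f)            ∎
  where open ≡-Reasoning
... | no v≢u = begin
  c ℚ.* φ v ℚ.+ lin φ f
    ≡⟨ cong (c ℚ.* φ v ℚ.+_) (lin-remove φ u f) ⟩
  c ℚ.* φ v ℚ.+ (coeff f u ℚ.* φ u ℚ.+ lin φ (remove u f))
    ≡⟨ ℚ-+.x∙yz≈y∙xz (c ℚ.* φ v) (coeff f u ℚ.* φ u) (lin φ (remove u f)) ⟩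
  coeff f u ℚ.* φ u ℚ.+ (c ℚ.* φ v ℚ.+ lin φ (remove u f))
    ≡⟨ cong (λ x → x ℚ.* φ u ℚ.+ (c ℚ.* φ v ℚ.+ lin φ (remove u f))) (ℚₚ.+-identityˡ (coeff f u)) ⟨
  (0ℚ ℚ.+ coeff f u) ℚ.* φ u ℚ.+ (c ℚ.* φ v ℚ.+ lin φ (remove u f)) ∎
  where open ≡-Reasoning

-- Since exponents may repeat in the list f, the recursion gathers all terms of
-- the head exponent at once; its measure is the length of the list.
lin-cong-support : {φ ψ : Exponent n → ℚ} (f : Poly n) →
                   (∀ u → coeff f u ≢ 0ℚ → φ u ≡ ψ u) → lin φ f ≡ lin ψ f
lin-cong-support {n} {φ} {ψ} f = go (length f) f ℕₚ.≤-refl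
  where
  go : ∀ N (f : Poly n) → length f ≤ N →
       (∀ u → coeff f u ≢ 0ℚ → φ u ≡ ψ u) → lin φ f ≡ lin ψ f
  go N       []             _         eq = refl
  go (suc N) f@((c , u) ∷ f′) (s≤s len) eq = begin
    lin φ f                                          ≡⟨ gather φ ⟩
    coeff f u ℚ.* φ u ℚ.+ lin φ (remove u f′)        ≡⟨ cong₂ ℚ._+_ at-u rest ⟩
    coeff f u ℚ.* ψ u ℚ.+ lin ψ (remove u f′)        ≡⟨ gather ψ ⟨
    lin ψ f                                          ∎
    where
    open ≡-Reasoning
    gather : ∀ χ → lin χ f ≡ coeff f u ℚ.* χ u ℚ.+ lin χ (remove u f′)
    gather χ = begin
      c ℚ.* χ u ℚ.+ lin χ f′
        ≡⟨ cong (c ℚ.* χ u ℚ.+_) (lin-remove χ u f′) ⟩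
      c ℚ.* χ u ℚ.+ (coeff f′ u ℚ.* χ u ℚ.+ lin χ (remove u f′))
        ≡⟨ ℚₚ.+-assoc (c ℚ.* χ u) _ _ ⟨
      c ℚ.* χ u ℚ.+ coeff f′ u ℚ.* χ u ℚ.+ lin χ (remove u f′)
        ≡⟨ cong (ℚ._+ lin χ (remove u f′)) (ℚₚ.*-distribʳ-+ (χ u) c (coeff f′ u)) ⟨
      (c ℚ.+ coeff f′ u) ℚ.* χ u ℚ.+ lin χ (remove u f′)
        ≡⟨ cong (λ x → x ℚ.* χ u ℚ.+ lin χ (remove u f′)) (coeff-≡ c f′ u) ⟨
      coeff f u ℚ.* χ u ℚ.+ lin χ (remove u f′) ∎
    -- The terms at `u` may cancel, and then `φ u` and `ψ u` are unrelated; both products vanish in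
    -- that case.
    at-u : coeff f u ℚ.* φ u ≡ coeff f u ℚ.* ψ u
    at-u with coeff f u ℚ.≟ 0ℚ
    ... | yes ≡0 = begin
      coeff f u ℚ.* φ u ≡⟨ cong (ℚ._* φ u) ≡0 ⟩
      0ℚ ℚ.* φ u        ≡⟨ ℚₚ.*-zeroˡ (φ u) ⟩
      0ℚ                ≡⟨ ℚₚ.*-zeroˡ (ψ u) ⟨
      0ℚ ℚ.* ψ u        ≡⟨ cong (ℚ._* ψ u) ≡0 ⟨
      coeff f u ℚ.* ψ u ∎
    ... | no ≢0  = cong (coeff f u ℚ.*_) (eq u ≢0)
    rest : lin φ (remove u f′) ≡ lin ψ (remove u f′)
    rest = go N (remove u f′) (ℕₚ.≤-trans (Listₚ.length-filter _ f′) len) λ v ≢0 →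
      let u≢v = λ where refl → ≢0 (coeff-remove-≡ u f′)
      in eq v λ ≡0 → ≢0 (trans (coeff-remove-≢ u≢v f′) (trans (sym (coeff-≢ c f′ u≢v)) ≡0))

-- No exponent has a nonzero coefficient, so `φ` may be replaced by `φ` times 0, and the factor 0
-- pulls out.
lin-≈0 : (φ : Exponent n → ℚ) (f : Poly n) → f ≈ 0ₚ → lin φ f ≡ 0ℚ
lin-≈0 φ f f≈0 = trans
  (lin-cong-support {ψ = λ u → φ u ℚ.* 0ℚ} f λ u ≢0 → contradiction (f≈0 u) ≢0)
  (trans (lin-*ʳ φ 0ℚ f) (ℚₚ.*-zeroʳ (lin φ f)))

-- Makes `lin φ` well defined on polynomials, although it is computed from a list of terms.
lin-≈ : (φ : Exponent n → ℚ) (f g : Poly n) → f ≈ g → lin φ f ≡ lin φ g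
lin-≈ φ f g f≈g = ℚ-sub-injective (trans (sym (lin-minus φ f g)) (lin-≈0 φ (f -ₚ g) λ s → begin
  coeff (f -ₚ g) s                ≡⟨ coeff-minus f g s ⟩
  coeff f s ℚ.- coeff g s         ≡⟨ cong (ℚ._- coeff g s) (f≈g s) ⟩
  coeff g s ℚ.- coeff g s         ≡⟨ ℚₚ.+-inverseʳ (coeff g s) ⟩
  0ℚ                              ∎))
  where
  open ≡-Reasoning
  ℚ-sub-injective : ∀ {p q} → p ℚ.- q ≡ 0ℚ → p ≡ q
  ℚ-sub-injective {p} {q} eq = begin
    p                     ≡⟨ ℚₚ.+-identityʳ p ⟨
    p ℚ.+ 0ℚ              ≡⟨ cong (p ℚ.+_) (ℚₚ.+-inverseˡ q) ⟨
    p ℚ.+ (ℚ.- q ℚ.+ q)   ≡⟨ ℚₚ.+-assoc p (ℚ.- q) q ⟨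
    p ℚ.- q ℚ.+ q         ≡⟨ cong (ℚ._+ q) eq ⟩
    0ℚ ℚ.+ q              ≡⟨ ℚₚ.+-identityˡ q ⟩
    q                     ∎

coeff-monomial-≡ : {u s : Exponent n} → u ≡ s → coeff (monomial u) s ≡ 1ℚ
coeff-monomial-≡ {u = u} refl = coeff-≡ 1ℚ [] u

coeff-monomial-≢ : {u s : Exponent n} → u ≢ s → coeff (monomial u) s ≡ 0ℚ
coeff-monomial-≢ = coeff-≢ 1ℚ []

1≢0 : 1ℚ ≢ 0ℚ
1≢0 ()

∈-support : (f : Poly n) {u : Exponent n} → coeff f u ≢ 0ℚ → Any (λ t → proj₂ t ≡ u) f
∈-support []            ≢0 = contradiction refl ≢0
∈-support ((c , v) ∷ f) {u} ≢0 with v ≟ₑ u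
... | yes v≡u = here v≡u
... | no  _   = there (∈-support f (≢0 ∘ trans (ℚₚ.+-identityˡ (coeff f u))))

-- Every exponent of nonzero coefficient occurs in the list, so a finite search settles a question
-- about all exponents.
searchSupport : {P : Pred (Exponent n) 0ℓ} → Decidable P → (f : Poly n) →
                (∃[ u ] coeff f u ≢ 0ℚ × P u) ⊎ (∀ u → coeff f u ≢ 0ℚ → ¬ P u)
searchSupport P? f with Any.any? (λ (_ , u) → ¬? (coeff f u ℚ.≟ 0ℚ) ×-dec P? u) f
... | yes found = let (_ , u) , ≢0 , Pu = Any.satisfied found in inj₁ (u , ≢0 , Pu)
... | no  none  = inj₂ λ u ≢0 Pu → none (Any.map (λ where refl → ≢0 , Pu) (∈-support f ≢0))

-- Substitution of monomials for the variables

monomial-^ₚ : (p : Exponent n) (x : ℕ) → monomial p ^ₚ x ≡ monomial (x ⊕.· p)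
monomial-^ₚ p zero    = refl
monomial-^ₚ p (suc x) = cong (monomial p *ₚ_) (monomial-^ₚ p x)

-- On a single term, the product of powers of monomials is the monomial with exponent
-- `combination τ u`; linearity does the rest. `σ` and `τ` are related pointwise because vectors are
-- functions, and `var Vector.++ (monomial ∘ a)` reduces only once its index is split.
substitute-monomials : (τ : Vector (Exponent n) m) (σ : Vector (Poly n) m) →
  (∀ i → σ i ≡ monomial (τ i)) →
  ∀ φ f → lin φ (substitute σ f) ≡ lin (φ ∘ combination τ) f
substitute-monomials τ σ σ≡τ φ []            = refl
substitute-monomials τ σ σ≡τ φ ((c , u) ∷ f) = begin
  lin φ (term c 𝟎 *ₚ powers +ₚ substitute σ f)
    ≡⟨ lin-+ₚ φ (term c 𝟎 *ₚ powers) _ ⟩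
  lin φ (term c 𝟎 *ₚ powers) ℚ.+ lin φ (substitute σ f)
    ≡⟨ cong₂ ℚ._+_ (lin-term-*ₚ φ c 𝟎 powers) (substitute-monomials τ σ σ≡τ φ f) ⟩
  c ℚ.* lin (φ ∘ (𝟎 ⊕_)) powers ℚ.+ lin (φ ∘ combination τ) f
    ≡⟨ cong (λ x → c ℚ.* x ℚ.+ _) (trans
         (cong (lin (φ ∘ (𝟎 ⊕_))) (trans (product (λ i → lookup u i)  σ τ σ≡τ)
                                         (cong monomial (sum-·≡combination τ u))))
         (trans (lin-monomial (φ ∘ (𝟎 ⊕_)) (combination τ u))
                (cong φ (⊕.identityˡ (combination τ u))))) ⟩
  c ℚ.* φ (combination τ u) ℚ.+ lin (φ ∘ combination τ) f ∎
  where
  open ≡-Reasoning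
  powers = Vector.foldr _*ₚ_ 1ₚ (λ i → σ i ^ₚ lookup u i)
  product : ∀ {n m} (x : Vector ℕ m) (σ : Vector (Poly n) m) (τ : Vector (Exponent n) m) →
            (∀ i → σ i ≡ monomial (τ i)) →
            Vector.foldr _*ₚ_ 1ₚ (λ i → σ i ^ₚ x i) ≡ monomial (⊕.sum λ i → x i ⊕.· τ i)
  product {m = zero}  x σ τ eq = refl
  product {m = suc m} x σ τ eq = cong₂ _*ₚ_
    (trans (cong (_^ₚ x zero) (eq zero)) (monomial-^ₚ (τ zero) (x zero)))
    (product (x ∘ suc) (σ ∘ suc) (τ ∘ suc) (eq ∘ suc))

-- Gröbner bases of ideals of relations

module RelationIdeal
  {N d r : ℕ} (_≺_ : Rel (Exponent N) 0ℓ) (deg : Exponent N → Exponent d)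
  (I : Pred (Poly N) 0ℓ) (B : Vector (Poly N) r)
  (≺-wellFounded : WellFounded _≺_)
  (≺-⊕ˡ : ∀ w {u v} → u ≺ v → (w ⊕ u) ≺ (w ⊕ v))
  -- Comparability is asked within one degree, the case that arises for the binomials of `I`.
  (≺-connected : ∀ {u v} → deg u ≡ deg v → u ≢ v → u ≺ v ⊎ v ≺ u)
  (deg-⊕ : ∀ u v → deg (u ⊕ v) ≡ deg u ⊕ deg v)
  -- The image of `f` under `deg` vanishes, expressed by testing it against every functional `θ` on
  -- degrees.
  (lin-deg : ∀ f → f ∈ I → ∀ θ → lin (θ ∘ deg) f ≡ 0ℚ)
  (binomial∈I : ∀ u v → deg u ≡ deg v → monomial u -ₚ monomial v ∈ I)
  (isReduced : IsReducedGroebnerBasis _≺_ I B)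
  where

  open IsReducedGroebnerBasis isReduced
  open IsGroebnerBasis isGroebnerBasis

  private
    ≺-asym : ∀ {u v} → u ≺ v → ¬ (v ≺ u)
    ≺-asym = wf⇒asym ≺-wellFounded

  -- Leading exponents and standard monomials.

  lead : Fin r → Exponent N
  lead i = proj₁ (monic i)

  lead-hasExp : ∀ i → HasExp _≺_ (B i) (lead i)
  lead-hasExp i = proj₁ (proj₂ (monic i))

  coeff-lead : ∀ i → coeff (B i) (lead i) ≡ 1ℚ
  coeff-lead i = proj₂ (proj₂ (monic i))

  hasExp-unique : ∀ f {e e′} → HasExp _≺_ f e → HasExp _≺_ f e′ → e ≡ e′
  hasExp-unique f {e} {e′} (e≢0 , e-max) (e′≢0 , e′-max) = decidable-stable (e ≟ₑ e′) λ e≢e′ →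
    ≺-asym (e-max e′ e′≢0 (e≢e′ ∘ sym)) (e′-max e e≢0 e≢e′)

  monomial-hasExp : ∀ u → HasExp _≺_ (monomial u) u
  monomial-hasExp u =
    (λ ≡0 → 1≢0 (trans (sym (coeff-monomial-≡ {u = u} refl)) ≡0)) ,
    λ m ≢0 m≢u → contradiction (coeff-monomial-≢ (m≢u ∘ sym)) ≢0

  binomial-hasExp : ∀ {u v} → v ≺ u → HasExp _≺_ (monomial u -ₚ monomial v) u
  binomial-hasExp {u} {v} v≺u = (λ ≡0 → 1≢0 (trans (sym coeff-u) ≡0)) , below
    where
    v≢u : v ≢ u
    v≢u refl = ≺-asym v≺u v≺u
    coeff-u : coeff (monomial u -ₚ monomial v) u ≡ 1ℚ
    coeff-u = trans (coeff-minus (monomial u) (monomial v) u)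
      (cong₂ ℚ._-_ (coeff-monomial-≡ {u = u} refl) (coeff-monomial-≢ v≢u))
    below : ∀ m → coeff (monomial u -ₚ monomial v) m ≢ 0ℚ → m ≢ u → m ≺ u
    below m ≢0 m≢u = subst (_≺ u) (decidable-stable (v ≟ₑ m) λ v≢m → ≢0
      (trans (coeff-minus (monomial u) (monomial v) m)
        (cong₂ ℚ._-_ (coeff-monomial-≢ (m≢u ∘ sym)) (coeff-monomial-≢ v≢m)))) v≺u

  -- Were `v` smaller, `monomial u -ₚ monomial v` would be an element of the ideal with leading
  -- exponent `u`.
  standard-least : ∀ {u v} → u ∉ E _≺_ B → deg u ≡ deg v → u ≢ v → u ≺ v
  standard-least u∉E eq u≢v with ≺-connected eq u≢v
  ... | inj₁ u≺v = u≺v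
  ... | inj₂ v≺u = contradiction (leading _ _ (binomial∈I _ _ eq) (binomial-hasExp v≺u)) u∉E

  -- Two distinct ones would each be smaller than the other.
  standard-unique : ∀ {u v} → u ∉ E _≺_ B → v ∉ E _≺_ B → deg u ≡ deg v → u ≡ v
  standard-unique {u} {v} u∉E v∉E eq = decidable-stable (u ≟ₑ v) λ u≢v →
    ≺-asym (standard-least u∉E eq u≢v) (standard-least v∉E (sym eq) (u≢v ∘ sym))

  -- Divisibility by another leading exponent is excluded by reducedness. A multiple of the leading
  -- exponent of `B i` itself cannot lie below that exponent.
  tail-standard : ∀ i m → coeff (B i) m ≢ 0ℚ → m ≢ lead i → m ∉ E _≺_ B
  tail-standard i m ≢0 m≢lead (j , e , w , hasExp , m≡e⊕w) with i Fin.≟ j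
  ... | no i≢j   = reduced i j i≢j m e w ≢0 hasExp m≡e⊕w
  ... | yes refl with hasExp-unique (B i) hasExp (lead-hasExp i)
  ...   | refl = ⊕-⊀ ≺-wellFounded ≺-⊕ˡ e w (subst (_≺ e) m≡e⊕w (proj₂ hasExp m ≢0 m≢lead))

  -- The functional on the left adds up all coefficients in the degree of `s`. Through it, the
  -- vanishing of an image under `deg` becomes information on a single coefficient.
  isolated-coeff : ∀ f s → (∀ u → coeff f u ≢ 0ℚ → deg u ≡ deg s → u ≡ s) →
                   lin (δ (deg s) ∘ deg) f ≡ coeff f s
  isolated-coeff f s isolated = trans (lin-cong-support f agree) (sym (coeff≡lin-δ f s))
    where
    agree : ∀ u → coeff f u ≢ 0ℚ → δ (deg s) (deg u) ≡ δ s u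
    agree u ≢0 with u ≟ₑ s
    ... | yes u≡s = δ-≡ (cong deg u≡s)
    ... | no u≢s  = δ-≢ (u≢s ∘ isolated u ≢0)

  -- The terms of B i below its leading one are standard, hence of distinct
  -- degrees, and the image of B i vanishes: only one of them can occur.
  basis-binomial : ∀ i → ∃[ t ] t ≺ lead i × deg t ≡ deg (lead i) ×
                   (∀ φ → lin φ (B i) ≡ φ (lead i) ℚ.- φ t)
  basis-binomial i with searchSupport (λ u → ¬? (u ≟ₑ lead i)) (B i)
  -- Without a tail, the leading coefficient 1 would be alone in its degree and would have to
  -- vanish.
  ... | inj₂ none = contradiction
    (trans (sym (coeff-lead i)) (trans
      (sym (isolated-coeff (B i) (lead i) λ u ≢0 _ → decidable-stable (u ≟ₑ lead i) (none u ≢0)))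
      (lin-deg (B i) (inIdeal i) (δ (deg (lead i))))))
    1≢0
  ... | inj₁ (t , t≢0 , t≢e) =
    t , proj₂ (lead-hasExp i) t t≢0 t≢e , tail-deg t t≢0 t≢e , λ φ →
      trans (expand φ) (cong₂ ℚ._+_ (ℚₚ.*-identityˡ (φ e))
        (trans (cong (ℚ._* φ t) coeff-t) (trans (sym (ℚₚ.neg-distribˡ-* 1ℚ (φ t))) (cong ℚ.-_ (ℚₚ.*-identityˡ (φ t))))))
    where
    e : Exponent N
    e = lead i
    -- A tail term in a degree other than that of `e` would be alone there, by uniqueness of
    -- standard exponents, so its coefficient would vanish.
    tail-deg : ∀ m → coeff (B i) m ≢ 0ℚ → m ≢ e → deg m ≡ deg e
    tail-deg m m≢0 m≢e = decidable-stable (deg m ≟ₑ deg e) λ deg≢ →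
      m≢0 (trans (sym (isolated-coeff (B i) m (isolated deg≢))) (lin-deg (B i) (inIdeal i) (δ (deg m))))
      where
      isolated : deg m ≢ deg e → ∀ u → coeff (B i) u ≢ 0ℚ → deg u ≡ deg m → u ≡ m
      isolated deg≢ u u≢0 eq with u ≟ₑ e
      ... | yes refl = contradiction (sym eq) deg≢
      ... | no u≢e   = standard-unique (tail-standard i u u≢0 u≢e) (tail-standard i m m≢0 m≢e) eq
    -- Only `e` and `t` occur in the support of `B i`, so `φ` can be replaced by its interpolation
    -- at these two exponents.
    expand : ∀ φ → lin φ (B i) ≡ 1ℚ ℚ.* φ e ℚ.+ coeff (B i) t ℚ.* φ t
    expand φ = begin
      lin φ (B i)
        ≡⟨ lin-cong-support (B i) agree ⟩
      lin (λ u → δ e u ℚ.* φ e ℚ.+ δ t u ℚ.* φ t) (B i)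
        ≡⟨ lin-sum (λ u → δ e u ℚ.* φ e) (λ u → δ t u ℚ.* φ t) (B i) ⟩
      lin (λ u → δ e u ℚ.* φ e) (B i) ℚ.+ lin (λ u → δ t u ℚ.* φ t) (B i)
        ≡⟨ cong₂ ℚ._+_ (lin-*ʳ (δ e) (φ e) (B i)) (lin-*ʳ (δ t) (φ t) (B i)) ⟩
      lin (δ e) (B i) ℚ.* φ e ℚ.+ lin (δ t) (B i) ℚ.* φ t
        ≡⟨ cong₂ (λ x y → x ℚ.* φ e ℚ.+ y ℚ.* φ t)
             (trans (sym (coeff-lead i)) (coeff≡lin-δ (B i) e)) (coeff≡lin-δ (B i) t) ⟨
      1ℚ ℚ.* φ e ℚ.+ coeff (B i) t ℚ.* φ t ∎
      where
      open ≡-Reasoning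
      agree : ∀ u → coeff (B i) u ≢ 0ℚ → φ u ≡ δ e u ℚ.* φ e ℚ.+ δ t u ℚ.* φ t
      agree u u≢0 with u ≟ₑ e
      ... | yes refl = sym (trans
        (cong₂ ℚ._+_ (ℚₚ.*-identityˡ (φ e)) (trans (cong (ℚ._* φ t) (δ-≢ (t≢e ∘ sym))) (ℚₚ.*-zeroˡ (φ t))))
        (ℚₚ.+-identityʳ (φ e)))
      ... | no u≢e with standard-unique (tail-standard i u u≢0 u≢e) (tail-standard i t t≢0 t≢e)
                          (trans (tail-deg u u≢0 u≢e) (sym (tail-deg t t≢0 t≢e)))
      ...   | refl = sym (trans
        (cong₂ ℚ._+_ (ℚₚ.*-zeroˡ (φ e)) (trans (cong (ℚ._* φ u) (δ-≡ {s = u} refl)) (ℚₚ.*-identityˡ (φ u))))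
        (ℚₚ.+-identityˡ (φ u)))
    -- The constant functional 1 factors through `deg`, so the two coefficients sum to zero.
    coeff-t : coeff (B i) t ≡ ℚ.- 1ℚ
    coeff-t = AbelianGroupProperties.inverseʳ-unique ℚₚ.+-0-abelianGroup 1ℚ (coeff (B i) t)
      (trans (cong (1ℚ ℚ.+_) (sym (ℚₚ.*-identityʳ (coeff (B i) t))))
        (trans (sym (expand (λ _ → 1ℚ))) (lin-deg (B i) (inIdeal i) (λ _ → 1ℚ))))

  -- Subtracting a monomial multiple of a binomial trades one monomial for another, so reduction can
  -- stay among monomials.
  reduces-monomial : ∀ i {u w} → u ≡ lead i ⊕ w →
    Reduces _≺_ B (monomial u) (monomial (w ⊕ proj₁ (basis-binomial i)))
  reduces-monomial i {u} {w} u≡e⊕w =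
    i , lead i , w , 1ℚ , lead-hasExp i , (λ ≡0 → 1≢0 (trans (sym coeff-u) ≡0)) ,
    trans (ℚₚ.*-identityˡ _) (trans (coeff-lead i) (sym coeff-u)) , same
    where
    t = proj₁ (basis-binomial i)
    u≡w⊕e : u ≡ w ⊕ lead i
    u≡w⊕e = trans u≡e⊕w (⊕.comm (lead i) w)
    coeff-u : coeff (monomial u) (w ⊕ lead i) ≡ 1ℚ
    coeff-u = coeff-monomial-≡ u≡w⊕e
    same : monomial (w ⊕ t) ≈ monomial u -ₚ term 1ℚ w *ₚ B i
    same s = begin
      coeff (monomial (w ⊕ t)) s
        ≡⟨ trans (coeff≡lin-δ (monomial (w ⊕ t)) s) (lin-monomial (δ s) (w ⊕ t)) ⟩
      δ s (w ⊕ t)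
        ≡⟨ x-[x-y]≡y (δ s (w ⊕ lead i)) (δ s (w ⊕ t)) ⟨
      δ s (w ⊕ lead i) ℚ.- (δ s (w ⊕ lead i) ℚ.- δ s (w ⊕ t))
        -- Applied to `B i`, the functional `δ s ∘ (w ⊕_)` reads off the coefficient at `s` of the
        -- multiple by `w`.
        ≡⟨ cong₂ ℚ._-_
             (trans (lin-monomial (δ s) u) (cong (δ s) u≡w⊕e))
             (trans (lin-term-*ₚ (δ s) 1ℚ w (B i)) (trans (ℚₚ.*-identityˡ _)
               (proj₂ (proj₂ (proj₂ (basis-binomial i))) (δ s ∘ (w ⊕_))))) ⟨
      lin (δ s) (monomial u) ℚ.- lin (δ s) (term 1ℚ w *ₚ B i)
        ≡⟨ lin-minus (δ s) (monomial u) (term 1ℚ w *ₚ B i) ⟨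
      lin (δ s) (monomial u -ₚ term 1ℚ w *ₚ B i)
        ≡⟨ coeff≡lin-δ (monomial u -ₚ term 1ℚ w *ₚ B i) s ⟨
      coeff (monomial u -ₚ term 1ℚ w *ₚ B i) s ∎
      where
      open ≡-Reasoning
      open import Data.Rational.Solver
      open +-*-Solver
      x-[x-y]≡y : ∀ x y → x ℚ.- (x ℚ.- y) ≡ y
      x-[x-y]≡y = solve 2 (λ x y → x :- (x :- y) := y) refl

  -- Well-founded recursion: while some leading exponent divides the monomial, a reduction step
  -- replaces it by a smaller one of the same degree.
  normalForm-monomial : ∀ u → ∃[ e ] IsNormalForm _≺_ B (monomial u) (monomial e) ×
                        e ∉ E _≺_ B × deg e ≡ deg u
  normalForm-monomial u = go u (≺-wellFounded u)
    where
    go : ∀ u → Acc _≺_ u → ∃[ e ] IsNormalForm _≺_ B (monomial u) (monomial e) ×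
                        e ∉ E _≺_ B × deg e ≡ deg u
    go u (acc rs) with Finₚ.any? (λ i → u multipleOf? lead i)
    ... | no irreducible = u , (ε , supported) , u∉E , refl
      where
      u∉E : u ∉ E _≺_ B
      u∉E (i , e , w , hasExp , u≡e⊕w) with hasExp-unique (B i) hasExp (lead-hasExp i)
      ... | refl = irreducible (i , w , u≡e⊕w)
      supported : ∀ m → coeff (monomial u) m ≢ 0ℚ → m ∉ E _≺_ B
      supported m ≢0 with u ≟ₑ m
      ... | yes refl = u∉E
      ... | no  _    = contradiction refl ≢0
    ... | yes (i , w , u≡e⊕w) =
      let t , t≺e , deg-t , _ = basis-binomial i
          u≡w⊕e = trans u≡e⊕w (⊕.comm (lead i) w)
          e , (steps , normal) , e∉E , deg-e =
            go (w ⊕ t) (rs (subst ((w ⊕ t) ≺_) (sym u≡w⊕e) (≺-⊕ˡ w t≺e)))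
      in e , (reduces-monomial i u≡e⊕w ◅ steps , normal) , e∉E , trans deg-e
           (trans (deg-⊕ w t) (trans (cong (deg w ⊕_) deg-t)
             (trans (sym (deg-⊕ w (lead i))) (cong deg (sym u≡w⊕e)))))

  -- The subtracted multiple of `B i` has image zero, since multiplication by a monomial translates
  -- degrees and `B i` lies in the ideal.
  lin-deg-reduces : ∀ θ f f′ → Reduces _≺_ B f f′ → lin (θ ∘ deg) f′ ≡ lin (θ ∘ deg) f
  lin-deg-reduces θ f f′ (i , e , w , c , _ , _ , _ , f′≈) = begin
    lin (θ ∘ deg) f′
      ≡⟨ lin-≈ (θ ∘ deg) f′ (f -ₚ term c w *ₚ B i) f′≈ ⟩
    lin (θ ∘ deg) (f -ₚ term c w *ₚ B i)
      ≡⟨ lin-minus (θ ∘ deg) f (term c w *ₚ B i) ⟩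
    lin (θ ∘ deg) f ℚ.- lin (θ ∘ deg) (term c w *ₚ B i)
      ≡⟨ cong (λ x → lin (θ ∘ deg) f ℚ.- x) vanishes ⟩
    lin (θ ∘ deg) f ℚ.- 0ℚ
      ≡⟨ ℚₚ.+-identityʳ (lin (θ ∘ deg) f) ⟩
    lin (θ ∘ deg) f ∎
    where
    open ≡-Reasoning
    vanishes : lin (θ ∘ deg) (term c w *ₚ B i) ≡ 0ℚ
    vanishes = trans (lin-term-*ₚ (θ ∘ deg) c w (B i)) (trans
      (cong (c ℚ.*_) (trans (lin-cong (λ u → cong θ (deg-⊕ w u)) (B i))
        (lin-deg (B i) (inIdeal i) (θ ∘ (deg w ⊕_)))))
      (ℚₚ.*-zeroʳ c))

  lin-deg-star : ∀ θ {f f′} → Star (Reduces _≺_ B) f f′ → lin (θ ∘ deg) f′ ≡ lin (θ ∘ deg) f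
  lin-deg-star θ ε = refl
  lin-deg-star θ {f} (_◅_ {j = g} step steps) =
    trans (lin-deg-star θ steps) (lin-deg-reduces θ f g step)

  -- Here `h` ends an arbitrary chain of reductions. Its exponents are standard, so `e` is alone in
  -- its degree and its coefficient is the sum over that degree. Reduction preserves this sum, which
  -- for `monomial u` is zero in every degree but `deg u`.
  deg-normalForm : ∀ {u h e} → IsNormalForm _≺_ B (monomial u) h → HasExp _≺_ h e → deg e ≡ deg u
  deg-normalForm {u} {h} {e} (steps , normal) (e≢0 , _) =
    decidable-stable (deg e ≟ₑ deg u) λ deg≢ → e≢0 (begin
      coeff h e
        ≡⟨ isolated-coeff h e (λ v v≢0 → standard-unique (normal v v≢0) (normal e e≢0)) ⟨
      lin (δ (deg e) ∘ deg) h             ≡⟨ lin-deg-star (δ (deg e)) steps ⟩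
      lin (δ (deg e) ∘ deg) (monomial u)  ≡⟨ lin-monomial (δ (deg e) ∘ deg) u ⟩
      δ (deg e) (deg u)                   ≡⟨ δ-≢ (deg≢ ∘ sym) ⟩
      0ℚ                                  ∎)
    where open ≡-Reasoning

-- Orderings

-- Transport along `k ∸ n + n ≡ k` lets the index be split into the first block and the last `n`
-- positions, those of the variables z.
<∸⊎last : (n≤k : n ≤ k) (j : Fin k) → toℕ j < k ∸ n ⊎ (∃[ i ] j ≡ last n≤k i)
<∸⊎last {n} {k} n≤k j with Fin.splitAt (k ∸ n) (cast (sym (ℕₚ.m∸n+n≡m n≤k)) j) in eq
... | inj₁ l = inj₁ (subst (_< k ∸ n) (trans (sym (Finₚ.toℕ-↑ˡ l n))
        (trans (cong toℕ (Finₚ.splitAt⁻¹-↑ˡ eq)) (Finₚ.toℕ-cast _ j))) (Finₚ.toℕ<n l))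
... | inj₂ i = inj₂ (i , Finₚ.toℕ-injective (trans
        (trans (sym (Finₚ.toℕ-cast _ j)) (cong toℕ (sym (Finₚ.splitAt⁻¹-↑ʳ eq))))
        (sym (Finₚ.toℕ-cast _ ((k ∸ n) ↑ʳ i)))))

module RevLexProperties {k : ℕ} (_◁_ : Rel (Fin k) 0ℓ)
  (isSTO : IsStrictTotalOrder _≡_ _◁_) where

  open IsStrictTotalOrder isSTO using (compare; isStrictPartialOrder)
    renaming (trans to ◁-trans; _<?_ to _◁?_)

  -- Well-founded descent; since `Fin k` is finite, it is decidable whether a smaller index
  -- satisfies `P`.
  least : {P : Pred (Fin k) 0ℓ} → Decidable P → ∀ j → P j → ∃[ i ] P i × (∀ l → l ◁ i → ¬ P l)
  least {P} P? j = go j (spo-wellFounded isStrictPartialOrder j)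
    where
    go : ∀ j → Acc _◁_ j → P j → ∃[ i ] P i × (∀ l → l ◁ i → ¬ P l)
    go j (acc rs) Pj with Finₚ.any? (λ l → (l ◁? j) ×-dec P? l)
    ... | yes (l , l◁j , Pl) = go l (rs l◁j) Pl
    ... | no none            = j , Pj , λ l l◁j Pl → none (l , l◁j , Pl)

  leastDifference : {u v : Exponent k} → u ≢ v →
    ∃[ j ] lookup u j ≢ lookup v j × (∀ i → i ◁ j → lookup u i ≡ lookup v i)
  leastDifference {u} {v} u≢v with Finₚ.any? (λ j → ¬? (lookup u j ℕ.≟ lookup v j))
  ... | no none = contradiction
    (lookup-injective λ j → decidable-stable (lookup u j ℕ.≟ lookup v j) λ ≢ → none (j , ≢)) u≢v
  ... | yes (j , ≢) =
    let i , ≢ᵢ , below = least (λ j → ¬? (lookup u j ℕ.≟ lookup v j)) j ≢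
    in i , ≢ᵢ , λ l l◁i → decidable-stable (lookup u l ℕ.≟ lookup v l) (below l l◁i)

  revLex-irrefl : ∀ {u} → ¬ RevLex _◁_ u u
  revLex-irrefl (_ , lt , _) = ℕₚ.<-irrefl refl lt

  revLex-trans : ∀ {u v w} → RevLex _◁_ u v → RevLex _◁_ v w → RevLex _◁_ u w
  revLex-trans {u} {v} {w} (i , lt , eq) (j , lt′ , eq′) with compare i j
  ... | tri< i◁j _ _  = i , subst (_< lookup u i) (eq′ i i◁j) lt ,
                        λ l l◁i → trans (eq l l◁i) (eq′ l (◁-trans l◁i i◁j))
  ... | tri≈ _ refl _ = i , ℕₚ.<-trans lt′ lt , λ l l◁i → trans (eq l l◁i) (eq′ l l◁i)
  ... | tri> _ _ j◁i  = j , subst (lookup w j <_) (sym (eq j j◁i)) lt′ ,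
                        λ l l◁j → trans (eq l (◁-trans l◁j j◁i)) (eq′ l l◁j)

  revLex-connected : ∀ {u v} → u ≢ v → RevLex _◁_ u v ⊎ RevLex _◁_ v u
  revLex-connected {u} {v} u≢v with leastDifference u≢v
  ... | j , ≢ , below with ℕₚ.<-cmp (lookup u j) (lookup v j)
  ...   | tri< lt _ _ = inj₂ (j , lt , λ i i◁j → sym (below i i◁j))
  ...   | tri≈ _ eq _ = contradiction eq ≢
  ...   | tri> _ _ gt = inj₁ (j , gt , below)

  revLex-⊕ˡ : ∀ w {u v} → RevLex _◁_ u v → RevLex _◁_ (w ⊕ u) (w ⊕ v)
  revLex-⊕ˡ w {u} {v} (j , lt , eq) =
    j , subst₂ _<_ (sym (lookup-⊕ v j)) (sym (lookup-⊕ u j)) (ℕₚ.+-monoʳ-< (lookup w j) lt) ,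
    λ i i◁j → trans (lookup-⊕ u i) (trans (cong (lookup w i +_) (eq i i◁j)) (sym (lookup-⊕ v i)))
    where
    lookup-⊕ : ∀ v i → lookup (w ⊕ v) i ≡ lookup w i + lookup v i
    lookup-⊕ v i = Vecₚ.lookup-zipWith _ i w v

  -- The smallest variable where `u` and `v` differ is one of the z: otherwise every z would be
  -- smaller still, and `v` would agree there with the z-free `u`. At that variable `u` has exponent
  -- 0, so `v` has the larger exponent.
  revLex-zfree : ∀ {n} (n≤k : n ≤ k) → (∀ i j → toℕ j < k ∸ n → last n≤k i ◁ j) →
    ∀ {u v} i → (∀ l → lookup u (last n≤k l) ≡ 0) → lookup v (last n≤k i) ≢ 0 → RevLex _◁_ v u
  revLex-zfree n≤k z◁y {u} {v} i u-zfree v≢0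
    with leastDifference {u} {v} (λ u≡v → v≢0 (trans (cong (λ w → lookup w (last n≤k i)) (sym u≡v)) (u-zfree i)))
  ... | j , ≢ , below with <∸⊎last n≤k j
  ...   | inj₁ j<k∸n = contradiction (trans (sym (below (last n≤k i) (z◁y i j j<k∸n))) (u-zfree i)) v≢0
  ...   | inj₂ (l , j≡) = j , ℕₚ.≤∧≢⇒< (subst (_≤ lookup v j) (sym u≡0) z≤n) ≢ ,
                          λ m m◁j → sym (below m m◁j)
    where
    u≡0 : lookup u j ≡ 0
    u≡0 = trans (cong (lookup u) j≡) (u-zfree l)

  -- Coding bounded exponents in a finite set turns RevLex on them into a strict
  -- order on a Fin, which is well-founded.
  decode : ∀ M → Fin (suc M ℕ.^ k) → Exponent k
  decode M x = tabulate (toℕ ∘ finToFun x)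

  encode : ∀ M (u : Exponent k) → (∀ j → lookup u j ≤ M) → Fin (suc M ℕ.^ k)
  encode M u u≤M = funToFin λ j → fromℕ< (s≤s (u≤M j))

  decode-encode : ∀ M u u≤M → decode M (encode M u u≤M) ≡ u
  decode-encode M u u≤M = lookup-injective λ j → trans (Vecₚ.lookup∘tabulate _ j)
    (trans (cong toℕ (Finₚ.finToFun-funToFin (λ j → fromℕ< (s≤s (u≤M j))) j))
      (Finₚ.toℕ-fromℕ< (s≤s (u≤M j))))

  revLex-isStrictPartialOrder : IsStrictPartialOrder _≡_ (RevLex _◁_)
  revLex-isStrictPartialOrder = record
    { isEquivalence = isEquivalence
    ; irrefl        = λ {u} → λ where refl → revLex-irrefl {u}
    ; trans         = λ {u} {v} {w} → revLex-trans {u} {v} {w}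
    ; <-resp-≈      = (λ {u} → subst (RevLex _◁_ u)) , (λ {v} → subst (λ u → RevLex _◁_ u v))
    }

  -- Well-foundedness on exponents with a common combination.

  module Fibres {d : ℕ} (a : Vector (Exponent d) k) (a≢𝟎 : ∀ j → a j ≢ 𝟎) where

    -- As soon as there is a variable, `RevLex` alone admits infinite descent: raising the exponent
    -- of the smallest variable makes a monomial smaller. Hence the restriction to one combination.
    _≺′_ : Rel (Exponent k) 0ℓ
    u ≺′ v = combination a u ≡ combination a v × RevLex _◁_ u v

    -- The bound `M` depends only on the combination, so one finite set of codes serves every
    -- descent from `v`.
    ≺′-wellFounded : WellFounded _≺′_
    ≺′-wellFounded v = go v refl (bound v refl)
      (spo-wellFounded (On.isStrictPartialOrder (decode M) revLex-isStrictPartialOrder) _)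
      where
      M : ℕ
      M = Vec.sum (combination a v)
      bound : ∀ u → combination a u ≡ combination a v → ∀ j → lookup u j ≤ M
      bound u eq j = subst (λ s → lookup u j ≤ Vec.sum s) eq (lookup≤sum-combination a a≢𝟎 u j)
      go : ∀ u → combination a u ≡ combination a v → (u≤M : ∀ j → lookup u j ≤ M) →
           Acc (RevLex _◁_ on decode M) (encode M u u≤M) → Acc _≺′_ u
      go u u~v u≤M (acc rs) = acc λ {w} (w~u , w≺u) →
        let w~v = trans w~u u~v
            w≤M = bound w w~v
        in go w w~v w≤M (rs (subst₂ (RevLex _◁_)
             (sym (decode-encode M w w≤M)) (sym (decode-encode M u u≤M)) w≺u))

    -- The block ordering and the ideal of relations.

    module BlockOrdering
      (_≺x_ _≺deg_ : Rel (Exponent d) 0ℓ)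
      (≺x-ordering : IsMonomialOrdering _≺x_) (≺deg-ordering : IsMonomialOrdering _≺deg_) where

      private
        module ≺x   = IsMonomialOrdering ≺x-ordering
        module ≺deg = IsMonomialOrdering ≺deg-ordering

      _≺y_ : Rel (Exponent k) 0ℓ
      _≺y_ = GradedRevLex a _≺deg_ _◁_

      _≺Λ_ : Rel (Exponent (d + k)) 0ℓ
      _≺Λ_ = Block _≺x_ _≺y_

      -- The exponent of the image of a monomial under the homomorphism with kernel `I[ a ]`.
      totalDegree : Exponent (d + k) → Exponent d
      totalDegree u = take d u ⊕ combination a (drop d u)

      totalDegree-⊕ : ∀ u v → totalDegree (u ⊕ v) ≡ totalDegree u ⊕ totalDegree v
      totalDegree-⊕ u v = trans
        (cong₂ _⊕_ (Vecₚ.take-zipWith _+_ u v)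
          (trans (cong (combination a) (Vecₚ.drop-zipWith _+_ u v))
            (combination-⊕ a (drop d u) (drop d v))))
        (⊕.interchange (take d u) (take d v) (combination a (drop d u)) (combination a (drop d v)))

      totalDegree-++ : ∀ x y → totalDegree (x Vec.++ y) ≡ x ⊕ combination a y
      totalDegree-++ x y = cong₂ _⊕_ (take-++ x y) (cong (combination a) (drop-++ x y))

      ≺y-wellFounded : WellFounded _≺y_
      ≺y-wellFounded = Subrelation.wellFounded
        -- Equality of combinations enters twice: as the tie in the lexicographic product and inside
        -- `_≺′_`.
        (λ { (inj₁ lt) → inj₁ lt ; (inj₂ (eq , lt)) → inj₂ (eq , eq , lt) })
        (On.wellFounded (λ u → combination a u , u)
          (×-wellFounded ≺deg.wellFounded ≺′-wellFounded))

      ≺Λ-wellFounded : WellFounded _≺Λ_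
      ≺Λ-wellFounded = On.wellFounded (λ u → take d u , drop d u)
        (×-wellFounded ≺x.wellFounded ≺y-wellFounded)

      ≺y-⊕ˡ : ∀ w {u v} → u ≺y v → (w ⊕ u) ≺y (w ⊕ v)
      ≺y-⊕ˡ w {u} {v} (inj₁ lt) = inj₁ (subst₂ _≺deg_
        (sym (combination-⊕ a w u)) (sym (combination-⊕ a w v))
        (monomialOrdering-⊕ˡ ≺deg-ordering (combination a w) lt))
      ≺y-⊕ˡ w {u} {v} (inj₂ (eq , lt)) = inj₂
        ( trans (combination-⊕ a w u) (trans (cong (combination a w ⊕_) eq) (sym (combination-⊕ a w v)))
        , revLex-⊕ˡ w lt)

      ≺Λ-⊕ˡ : ∀ w {u v} → u ≺Λ v → (w ⊕ u) ≺Λ (w ⊕ v)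
      ≺Λ-⊕ˡ w {u} {v} (inj₁ lt) = inj₁ (subst₂ _≺x_
        (sym (Vecₚ.take-zipWith _+_ w u)) (sym (Vecₚ.take-zipWith _+_ w v))
        (monomialOrdering-⊕ˡ ≺x-ordering (take d w) lt))
      ≺Λ-⊕ˡ w {u} {v} (inj₂ (eq , lt)) = inj₂
        ( trans (Vecₚ.take-zipWith _+_ w u)
            (trans (cong (take d w ⊕_) eq) (sym (Vecₚ.take-zipWith _+_ w v)))
        , subst₂ _≺y_ (sym (Vecₚ.drop-zipWith _+_ w u)) (sym (Vecₚ.drop-zipWith _+_ w v))
            (≺y-⊕ˡ (drop d w) lt))

      -- If the x-parts coincide, cancelling them from the total degrees leaves equal combinations,
      -- and the reverse lexicographic tie-break decides.
      ≺Λ-connected : ∀ {u v} → totalDegree u ≡ totalDegree v → u ≢ v → u ≺Λ v ⊎ v ≺Λ u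
      ≺Λ-connected {u} {v} deg≡ u≢v
        with IsStrictTotalOrder.compare ≺x.isStrictTotalOrder (take d u) (take d v)
      ... | tri< lt _ _ = inj₁ (inj₁ lt)
      ... | tri> _ _ gt = inj₂ (inj₁ gt)
      ... | tri≈ _ eq _ with revLex-connected {drop d u} {drop d v} (λ eq′ → u≢v
              (trans (sym (Vecₚ.take++drop≡id d u))
                (trans (cong₂ Vec._++_ eq eq′) (Vecₚ.take++drop≡id d v))))
      ...   | inj₁ lt = inj₁ (inj₂ (eq , inj₂ (comb≡ , lt)))
        where comb≡ = ⊕-cancelˡ (take d v) (trans (cong (_⊕ _) (sym eq)) deg≡)
      ...   | inj₂ gt = inj₂ (inj₂ (sym eq , inj₂ (comb≡ , gt)))
        where comb≡ = sym (⊕-cancelˡ (take d v) (trans (cong (_⊕ _) (sym eq)) deg≡))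

      lin-substitute : ∀ θ f →
        lin θ (substitute (var Vector.++ (monomial ∘ a)) f) ≡ lin (θ ∘ totalDegree) f
      lin-substitute θ f = trans
        (substitute-monomials (unit Vector.++ a) (var Vector.++ (monomial ∘ a)) images θ f)
        (lin-cong (λ u → cong θ (trans (combination-++ unit a u)
          (cong (_⊕ combination a (drop d u)) (combination-units (take d u))))) f)
        where
        images : ∀ i → (var Vector.++ (monomial ∘ a)) i ≡ monomial ((unit Vector.++ a) i)
        images i with Fin.splitAt d i
        ... | inj₁ _ = refl
        ... | inj₂ _ = refl

      lin-totalDegree : ∀ f → f ∈ I[ a ] → ∀ θ → lin (θ ∘ totalDegree) f ≡ 0ℚ
      lin-totalDegree f f∈I θ = trans (sym (lin-substitute θ f)) (lin-≈0 θ (substitute (var Vector.++ (monomial ∘ a)) f) f∈I)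

      -- Both monomials have the same image, so their difference is sent to zero.
      binomial∈I : ∀ u v → totalDegree u ≡ totalDegree v → monomial u -ₚ monomial v ∈ I[ a ]
      binomial∈I u v eq s = begin
        coeff (substitute (var Vector.++ (monomial ∘ a)) (monomial u -ₚ monomial v)) s
          ≡⟨ coeff≡lin-δ (substitute (var Vector.++ (monomial ∘ a)) (monomial u -ₚ monomial v)) s ⟩
        lin (δ s) (substitute (var Vector.++ (monomial ∘ a)) (monomial u -ₚ monomial v))
          ≡⟨ lin-substitute (δ s) (monomial u -ₚ monomial v) ⟩
        lin (δ s ∘ totalDegree) (monomial u -ₚ monomial v)
          ≡⟨ lin-minus (δ s ∘ totalDegree) (monomial u) (monomial v) ⟩
        lin (δ s ∘ totalDegree) (monomial u) ℚ.- lin (δ s ∘ totalDegree) (monomial v)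
          ≡⟨ cong₂ ℚ._-_ (lin-monomial (δ s ∘ totalDegree) u) (lin-monomial (δ s ∘ totalDegree) v) ⟩
        δ s (totalDegree u) ℚ.- δ s (totalDegree v)
          ≡⟨ cong (λ p → δ s p ℚ.- δ s (totalDegree v)) eq ⟩
        δ s (totalDegree v) ℚ.- δ s (totalDegree v)
          ≡⟨ ℚₚ.+-inverseʳ (δ s (totalDegree v)) ⟩
        0ℚ ∎
        where open ≡-Reasoning

-- Apéry sets

toℤ : Exponent d → Vec ℤ d
toℤ v = Vec.map ℤ.+_ v

toℤ-injective : {u v : Exponent d} → toℤ u ≡ toℤ v → u ≡ v
toℤ-injective {u = []}    {[]}    _  = refl
toℤ-injective {u = _ ∷ _} {_ ∷ _} eq =
  let head≡ , tail≡ = Vecₚ.∷-injective eq in cong₂ _∷_ (ℤₚ.+-injective head≡) (toℤ-injective tail≡)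

toℤ-⊕ : (u v : Exponent d) → toℤ (u ⊕ v) ≡ zipWith ℤ._+_ (toℤ u) (toℤ v)
toℤ-⊕ []      []      = refl
toℤ-⊕ (x ∷ u) (y ∷ v) = cong (ℤ.+ (x + y) ∷_) (toℤ-⊕ u v)

-+-cancel : (x y : Vec ℤ d) → zipWith ℤ._+_ y (zipWith ℤ._-_ x y) ≡ x
-+-cancel []      []      = refl
-+-cancel (x ∷ u) (y ∷ v) = cong₂ _∷_
  (trans (sym (ℤₚ.+-assoc y x (ℤ.- y))) (AbelianGroupProperties.xyx⁻¹≈y ℤₚ.+-0-abelianGroup y x))
  (-+-cancel u v)

+--cancel : (x y : Vec ℤ d) → zipWith ℤ._-_ (zipWith ℤ._+_ y x) y ≡ x
+--cancel []      []      = refl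
+--cancel (x ∷ u) (y ∷ v) = cong₂ _∷_
  (AbelianGroupProperties.xyx⁻¹≈y ℤₚ.+-0-abelianGroup y x) (+--cancel u v)

difference∈Monoid : (a : Vector (Exponent d) k) {x b : Exponent d} (u : Exponent k) →
  x ≡ b ⊕ combination a u → zipWith ℤ._-_ (toℤ x) (toℤ b) ∈ Monoid⟨ a ⟩
difference∈Monoid a {b = b} u refl = u , trans
  (cong (λ z → zipWith ℤ._-_ z (toℤ b)) (toℤ-⊕ b (combination a u)))
  (+--cancel (toℤ (combination a u)) (toℤ b))

-- Adding `b` back turns the integer difference into an equation that already holds among natural
-- exponents.
difference∈Monoid⁻¹ : (a : Vector (Exponent d) k) {x b : Exponent d} →
  zipWith ℤ._-_ (toℤ x) (toℤ b) ∈ Monoid⟨ a ⟩ → ∃[ u ] x ≡ b ⊕ combination a u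
difference∈Monoid⁻¹ a {x} {b} (u , eq) = u , toℤ-injective (begin
  toℤ x
    ≡⟨ -+-cancel (toℤ x) (toℤ b) ⟨
  zipWith ℤ._+_ (toℤ b) (zipWith ℤ._-_ (toℤ x) (toℤ b))
    ≡⟨ cong (zipWith ℤ._+_ (toℤ b)) eq ⟩
  zipWith ℤ._+_ (toℤ b) (toℤ (combination a u))
    ≡⟨ toℤ-⊕ b (combination a u) ⟨
  toℤ (b ⊕ combination a u) ∎)
  where open ≡-Reasoning

-- A positive exponent at `i` is what keeps the truncated subtraction exact.
unit⊕∸unit : (i : Fin n) (u : Exponent n) → lookup u i ≢ 0 → u ≡ unit i ⊕ zipWith _∸_ u (unit i)
unit⊕∸unit zero    (zero  ∷ u) ≢0 = contradiction refl ≢0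
unit⊕∸unit zero    (suc x ∷ u) ≢0 = cong (suc x ∷_) (𝟎⊕∸𝟎 u)
  where
  𝟎⊕∸𝟎 : ∀ {n} (u : Exponent n) → u ≡ 𝟎 ⊕ zipWith _∸_ u 𝟎
  𝟎⊕∸𝟎 []      = refl
  𝟎⊕∸𝟎 (x ∷ u) = cong (x ∷_) (𝟎⊕∸𝟎 u)
unit⊕∸unit (suc i) (x ∷ u) ≢0 = cong (x ∷_) (unit⊕∸unit i u ≢0)

-- The two inclusions between `Q` and the Apéry set.

theorem8 : (d k n : ℕ) (n≤k : n ≤ k)
    (a : Vector (Exponent d) k) →
    (∀ j → a j ≢ 𝟎) →
    pos a ≐ pos (Λ n≤k a) →
    (_≺x_ _≺deg_ : Rel (Exponent d) 0ℓ) →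
    IsMonomialOrdering _≺x_ →
    IsMonomialOrdering _≺deg_ →
    (_◁_ : Rel (Fin k) 0ℓ) →
    IsStrictTotalOrder _≡_ _◁_ →
    (∀ i j → toℕ j < k ∸ n → last n≤k i ◁ j) →
    let _≺Λ_ = Block _≺x_ (GradedRevLex a _≺deg_ _◁_) in
    (r : ℕ) (B : Vector (Poly (d + k)) r) →
    IsReducedGroebnerBasis _≺Λ_ I[ a ] B →
    Q n≤k _≺Λ_ B ≐ Ap a (Λ n≤k a)
theorem8 d k n n≤k a a≢𝟎 _ _≺x_ _≺deg_ ≺x-ordering ≺deg-ordering _◁_ isSTO z◁y r B isReduced =
  Q⊆Ap , Ap⊆Q
  where
  open RevLexProperties _◁_ isSTO
  open Fibres a a≢𝟎
  open BlockOrdering _≺x_ _≺deg_ ≺x-ordering ≺deg-ordering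
  open RelationIdeal _≺Λ_ totalDegree I[ a ] B
    ≺Λ-wellFounded ≺Λ-⊕ˡ ≺Λ-connected totalDegree-⊕ lin-totalDegree binomial∈I isReduced

  x₀ : Exponent d → Exponent (d + k)
  x₀ x = x Vec.++ 𝟎

  totalDegree-x₀ : ∀ x → totalDegree (x₀ x) ≡ x
  totalDegree-x₀ x = trans (totalDegree-++ x 𝟎)
    (trans (cong (x ⊕_) (combination-𝟎 a)) (⊕.identityʳ x))

  totalDegree-y : ∀ e → take d e ≡ 𝟎 → totalDegree e ≡ combination a (drop d e)
  totalDegree-y e eq = trans (cong (_⊕ combination a (drop d e)) eq) (⊕.identityˡ _)

  Q⊆Ap : ∀ {x} → x ∈ Q n≤k _≺Λ_ B → x ∈ Ap a (Λ n≤k a)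
  Q⊆Ap {x} (h , e , isNF , hasExp , x-free , z-free , e∉E) =
    (drop d e , cong (toℤ) (sym degree)) , no-difference
    where
    degree : combination a (drop d e) ≡ x
    degree = trans (sym (totalDegree-y e x-free))
      (trans (deg-normalForm isNF hasExp) (totalDegree-x₀ x))

    no-difference : ∀ i →
      zipWith ℤ._-_ (toℤ x) (toℤ (a (last n≤k i))) ∉ Monoid⟨ a ⟩
    -- The standard exponent `e` is least in its degree, whereas `𝟎 Vec.++ v` has the same degree
    -- and is smaller because a z divides it.
    no-difference i difference = wf⇒asym ≺Λ-wellFounded v≺e
      (standard-least e∉E deg≡ λ e≡v → wf⇒asym ≺Λ-wellFounded v≺e (subst₂ _≺Λ_ (sym e≡v) e≡v v≺e))
      where
      u : Exponent k
      u = proj₁ (difference∈Monoid⁻¹ a difference)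
      x≡aᵢ⊕u : x ≡ a (last n≤k i) ⊕ combination a u
      x≡aᵢ⊕u = proj₂ (difference∈Monoid⁻¹ a difference)
      -- A representation of `x` that uses the generator `a (last n≤k i)` at least once.
      v : Exponent k
      v = unit (last n≤k i) ⊕ u
      combination-v : combination a v ≡ x
      combination-v = trans (combination-⊕ a (unit (last n≤k i)) u)
        (trans (cong (_⊕ combination a u) (combination-unit a (last n≤k i))) (sym x≡aᵢ⊕u))
      v≢0 : lookup v (last n≤k i) ≢ 0
      v≢0 ≡0 = contradiction
        (trans (sym (trans (Vecₚ.lookup-zipWith _ (last n≤k i) (unit (last n≤k i)) u)
          (cong (_+ lookup u (last n≤k i)) (Vecₚ.lookup∘update (last n≤k i) 𝟎 1)))) ≡0)
        λ ()
      v≺e : (𝟎 Vec.++ v) ≺Λ e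
      v≺e = inj₂
        ( trans (take-++ 𝟎 v) (sym x-free)
        , subst (_≺y drop d e) (sym (drop-++ (𝟎 {n = d}) v))
            (inj₂ (trans combination-v (sym degree) , revLex-zfree n≤k z◁y {drop d e} {v} i z-free v≢0)))
      deg≡ : totalDegree e ≡ totalDegree (𝟎 Vec.++ v)
      deg≡ = trans (totalDegree-y e x-free) (trans degree (trans (sym combination-v)
        (sym (trans (totalDegree-++ 𝟎 v) (⊕.identityˡ _)))))

  Ap⊆Q : ∀ {x} → x ∈ Ap a (Λ n≤k a) → x ∈ Q n≤k _≺Λ_ B
  Ap⊆Q {x} ((u , x≡) , apéry) =
    monomial e , e , isNF , monomial-hasExp e , x-free , z-free , e∉E
    where
    normalForm : ∃[ e ] IsNormalForm _≺Λ_ B (monomial (x₀ x)) (monomial e) ×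
                        e ∉ E _≺Λ_ B × totalDegree e ≡ totalDegree (x₀ x)
    normalForm = normalForm-monomial (x₀ x)
    e : Exponent (d + k)
    e = proj₁ normalForm
    isNF = proj₁ (proj₂ normalForm)
    e∉E = proj₁ (proj₂ (proj₂ normalForm))
    deg-e = proj₂ (proj₂ (proj₂ normalForm))
    -- Membership of `x` in the monoid supplies an x-free competitor of the same degree.
    y : Exponent (d + k)
    y = 𝟎 Vec.++ u
    degree : totalDegree e ≡ x
    degree = trans deg-e (totalDegree-x₀ x)
    deg≡ : totalDegree e ≡ totalDegree y
    deg≡ = trans degree (trans (toℤ-injective x≡)
      (sym (trans (totalDegree-++ 𝟎 u) (⊕.identityˡ _))))
    -- Every `p` is a multiple of `𝟎`, and a multiple is never smaller.
    ⊀x𝟎 : ∀ {p} → ¬ (p ≺x 𝟎)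
    ⊀x𝟎 {p} lt = ⊕-⊀ (IsMonomialOrdering.wellFounded ≺x-ordering) (monomialOrdering-⊕ˡ ≺x-ordering)
      𝟎 p (subst (_≺x 𝟎) (sym (⊕.identityˡ p)) lt)
    -- Unless `e` equals `y`, it is smaller than `y`; as x-parts are compared first, its x-part is
    -- either below `𝟎`, which is impossible, or equal to it.
    x-free : take d e ≡ 𝟎
    x-free = decidable-stable (take d e ≟ₑ 𝟎) λ ≢𝟎 →
      case standard-least e∉E deg≡ (λ e≡y → ≢𝟎 (trans (cong (take d) e≡y) (take-++ 𝟎 u))) of λ where
        (inj₁ lt)       → ⊀x𝟎 (subst (take d e ≺x_) (take-++ 𝟎 u) lt)
        (inj₂ (eq , _)) → ≢𝟎 (trans eq (take-++ 𝟎 u))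
    -- If the variable at `last n≤k i` divided `e`, the cofactor `w` would exhibit the difference of
    -- `x` and that generator as an element of the monoid.
    z-free : ∀ i → lookup (drop d e) (last n≤k i) ≡ 0
    z-free i = decidable-stable (lookup (drop d e) (last n≤k i) ℕ.≟ 0) λ ≢0 →
      let z = unit (last n≤k i)
          w = zipWith _∸_ (drop d e) z
      in apéry i (difference∈Monoid a w (trans (sym degree) (trans (totalDegree-y e x-free)
           (trans (cong (combination a) (unit⊕∸unit (last n≤k i) (drop d e) ≢0))
             (trans (combination-⊕ a z w)
               (cong (_⊕ combination a w) (combination-unit a (last n≤k i))))))))
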